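{- For every positive integer $n$, $$\frac{1}{\mathrm{Cat}_n^2}\sum_{\pi,\rho\in\mathrm{NC}(n)}d_H(\pi,\rho)\ge\frac{n-1}{2}.$$
   Context: For a positive integer $n$, a partition $\pi$ of $\{1,\ldots,n\}$ is non-crossing if there are no two distinct blocks $V,W$ of $\pi$ and numbers $a<b<c<d$ with $a,c\in V$ and $b,d\in W$. $\mathrm{NC}(n)$ is the set of non-crossing partitions of $\{1,\ldots,n\}$, partially ordered by $\pi\le\rho$ iff every block of $\pi$ is contained in a block of $\rho$. The Hasse diagram $\mathcal{H}_n$ is the undirected graph with vertex set $\mathrm{NC}(n)$ in which $\pi_1,\pi_2$ are joined by an edge iff one of them covers the other in $(\mathrm{NC}(n),\le)$; $d_H(\pi,\rho)$ is the graph distance in $\mathcal{H}_n$. $\mathrm{Cat}_n=\frac{(2n)!}{n!(n+1)!}=|\mathrm{NC}(n)|$ is the $n$th Catalan number. -}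

module Defs where

open import Data.Fin using (Fin)
import Data.Fin as Fin
import Data.Fin.Properties as Fin
open import Data.Fin.Subset using (Subset; inside; outside; ⊤; _∈_; _⊆_)
open import Data.Fin.Subset.Properties
  using (_∈?_; _⊆?_; ⊆-trans; ⊆-antisym; ⊆⊤; ∈⊤)
open import Data.Bool.Properties using () renaming (_≟_ to _≟ᵇ_)
open import Data.Integer using (+_)
open import Data.Irrelevant using ([_])
open import Data.List using (List; []; _∷_; cartesianProductWith; map; length; filter)
open import Data.List.Membership.Propositional using (lose) renaming (_∈_ to _∈ₗ_)
open import Data.List.Membership.Propositional.Properties using (∈-cartesianProductWith⁺)
open import Data.List.Relation.Unary.All using (All; []; _∷_)
open import Data.List.Relation.Unary.Any using (here; there; satisfied)
import Data.List.Relation.Unary.Any as Any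
open import Data.List.Relation.Unary.AllPairs using ([]; _∷_)
open import Data.List.Relation.Unary.Unique.Propositional using (Unique)
import Data.List.Relation.Unary.Unique.Propositional.Properties as Unique
open import Data.Nat using (ℕ; zero; suc; _+_; _*_; _≤_; _<_; z≤n; s≤s; _!)
open import Data.Nat.ListAction using (sum)
open import Data.Nat.Induction using (<-wellFounded)
open import Data.Nat.Properties using (m≤n⇒m≤1+n; _!≢0; m*n≢0)
open import Data.Product using (Σ; ∃; _×_; _,_; proj₁; proj₂)
open import Data.Rational as ℚ using (ℚ; _/_)
import Data.Rational.Properties as ℚ
open import Data.Refinement using (Refinement; value; value-injective) renaming (_,_ to _,ᵣ_)
open import Data.Sum using (_⊎_; inj₁; inj₂; swap)
open import Data.Vec using (Vec; []; _∷_; lookup; replicate)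
open import Data.Vec.Properties using (≡-dec; lookup-replicate; ∷-injective)
open import Data.Vec.Relation.Binary.Pointwise.Extensional using (ext; Pointwise-≡⇒≡)
open import Function using (_∘_)
open import Induction.WellFounded using (Acc; acc)
open import Level using (0ℓ)
open import Relation.Binary.PropositionalEquality
  using (_≡_; _≢_; refl; sym; trans; cong; subst)
open import Relation.Nullary using (¬_; Dec; yes; no; ¬?; contradiction; recompute)
open import Relation.Nullary.Decidable using (_×-dec_; _⊎-dec_; _→-dec_; map′)
open import Relation.Unary using (Pred; Decidable)

private
  variable
    n : ℕ

-- A partition of an n-element set is represented by the vector whose i-th
-- entry is the block containing i.  The blocks are exactly the entries, and
-- each partition has exactly one such representation.  The ground set is
-- Fin n, i.e. {1,…,n} shifted by one.

BlockMap : ℕ → Set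
BlockMap n = Vec (Subset n) n

record IsPartition (B : BlockMap n) : Set where
  constructor isPartition
  field
    covers   : ∀ i → i ∈ lookup B i
    coherent : ∀ i j → j ∈ lookup B i → lookup B j ≡ lookup B i

Crossing : BlockMap n → Set
Crossing {n} B =
  Σ (Fin n) λ i → Σ (Fin n) λ j →
  let V = lookup B i ; W = lookup B j in
  V ≢ W ×
  (Σ (Fin n) λ a → Σ (Fin n) λ b → Σ (Fin n) λ c → Σ (Fin n) λ d →
    (a Fin.< b × b Fin.< c × c Fin.< d) ×
    (a ∈ V × c ∈ V) × (b ∈ W × d ∈ W))

IsNC : BlockMap n → Set
IsNC B = IsPartition B × ¬ Crossing B

-- The proof component is irrelevant, so elements of NC n are equal as soon as
-- their block vectors are.

NC : ℕ → Set
NC n = Refinement (BlockMap n) IsNC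

block : NC n → Fin n → Subset n
block π = lookup (value π)

_≟ˢ_ : (V W : Subset n) → Dec (V ≡ W)
_≟ˢ_ = ≡-dec _≟ᵇ_

isPartition? : (B : BlockMap n) → Dec (IsPartition B)
isPartition? B = map′
  (λ (p , q) → isPartition p q)
  (λ (isPartition p q) → p , q)
  (Fin.all? (λ i → i ∈? lookup B i) ×-dec
   Fin.all? (λ i → Fin.all? λ j →
     (j ∈? lookup B i) →-dec (lookup B j ≟ˢ lookup B i)))

crossing? : (B : BlockMap n) → Dec (Crossing B)
crossing? B =
  Fin.any? λ i → Fin.any? λ j →
  let V = lookup B i ; W = lookup B j in
  ¬? (V ≟ˢ W) ×-dec
  (Fin.any? λ a → Fin.any? λ b → Fin.any? λ c → Fin.any? λ d →
    ((a Fin.<? b) ×-dec ((b Fin.<? c) ×-dec (c Fin.<? d))) ×-dec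
    (((a ∈? V) ×-dec (c ∈? V)) ×-dec ((b ∈? W) ×-dec (d ∈? W))))

isNC? : (B : BlockMap n) → Dec (IsNC B)
isNC? B = isPartition? B ×-dec ¬? (crossing? B)

isNC : (π : NC n) → IsNC (value π)
isNC (B ,ᵣ [ p ]) = recompute (isNC? B) p

_≟ᴺ_ : (π ρ : NC n) → Dec (π ≡ ρ)
π ≟ᴺ ρ = map′ value-injective (cong value) (≡-dec _≟ˢ_ (value π) (value ρ))

vectors : {A : Set} → List A → ∀ m → List (Vec A m)
vectors xs zero    = [] ∷ []
vectors xs (suc m) = cartesianProductWith _∷_ xs (vectors xs m)

allBlockMaps : ∀ n → List (BlockMap n)
allBlockMaps n = vectors (vectors (inside ∷ outside ∷ []) n) n

selectNC : List (BlockMap n) → List (NC n)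
selectNC []       = []
selectNC (B ∷ Bs) with isNC? B
... | yes p = (B ,ᵣ [ p ]) ∷ selectNC Bs
... | no  _ = selectNC Bs

allNC : ∀ n → List (NC n)
allNC n = selectNC (allBlockMaps n)

vectors-complete : {A : Set} {xs : List A} → (∀ x → x ∈ₗ xs) →
                   ∀ {m} (v : Vec A m) → v ∈ₗ vectors xs m
vectors-complete h []      = here refl
vectors-complete h (x ∷ v) = ∈-cartesianProductWith⁺ _∷_ (h x) (vectors-complete h v)

vectors-unique : {A : Set} {xs : List A} → Unique xs → ∀ m → Unique (vectors xs m)
vectors-unique u zero    = [] ∷ []
vectors-unique u (suc m) =
  Unique.cartesianProductWith⁺ _∷_ ∷-injective u (vectors-unique u m)

selectNC-complete : {Bs : List (BlockMap n)} (π : NC n) → value π ∈ₗ Bs → π ∈ₗ selectNC Bs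
selectNC-complete {Bs = B ∷ Bs} π B∈ with isNC? B | B∈
... | yes p | here  eq = here (value-injective eq)
... | yes p | there h  = there (selectNC-complete π h)
... | no ¬p | here  eq = contradiction (subst IsNC eq (isNC π)) ¬p
... | no ¬p | there h  = selectNC-complete π h

selectNC-≢ : {B : BlockMap n} {Bs : List (BlockMap n)} (π : NC n) → value π ≡ B →
             All (B ≢_) Bs → All (π ≢_) (selectNC Bs)
selectNC-≢ π eq [] = []
selectNC-≢ {Bs = C ∷ Bs} π eq (B≢C ∷ h) with isNC? C
... | yes p = (λ π≡ → B≢C (trans (sym eq) (cong value π≡))) ∷ selectNC-≢ π eq h
... | no  _ = selectNC-≢ π eq h

selectNC-unique : {Bs : List (BlockMap n)} → Unique Bs → Unique (selectNC Bs)
selectNC-unique [] = []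
selectNC-unique {Bs = B ∷ Bs} (h ∷ u) with isNC? B
... | yes p = selectNC-≢ _ refl h ∷ selectNC-unique u
... | no  _ = selectNC-unique u

allNC-complete : (π : NC n) → π ∈ₗ allNC n
allNC-complete π = selectNC-complete π
  (vectors-complete (vectors-complete λ where
    inside  → here refl
    outside → there (here refl)) (value π))

allNC-unique : ∀ n → Unique (allNC n)
allNC-unique n = selectNC-unique
  (vectors-unique (vectors-unique (((λ ()) ∷ []) ∷ [] ∷ []) n) n)

∑NC : (NC n → ℕ) → ℕ
∑NC {n} f = sum (map f (allNC n))

exists? : {P : Pred (NC n) 0ℓ} → Decidable P → Dec (∃ P)
exists? {n} P? = map′ satisfied (λ (π , p) → lose (allNC-complete π) p) (Any.any? P? (allNC n))

infix 4 _⊑_ _⊏_ _⋖_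

_⊑_ : NC n → NC n → Set
_⊑_ {n} π ρ = ∀ (i : Fin n) → Σ (Fin n) λ j → block π i ⊆ block ρ j

_⊏_ : NC n → NC n → Set
π ⊏ ρ = π ⊑ ρ × π ≢ ρ

-- π ⋖ ρ: ρ covers π.
_⋖_ : NC n → NC n → Set
_⋖_ {n} π ρ = π ⊏ ρ × ¬ (Σ (NC n) λ σ → π ⊏ σ × σ ⊏ ρ)

Adjacent : NC n → NC n → Set
Adjacent π ρ = π ⋖ ρ ⊎ ρ ⋖ π

data Walk {n : ℕ} : ℕ → NC n → NC n → Set where
  []  : ∀ {π} → Walk 0 π π
  _∷_ : ∀ {k π σ ρ} → Adjacent π σ → Walk k σ ρ → Walk (suc k) π ρ

IsDistance : NC n → NC n → ℕ → Set
IsDistance π ρ d = Walk d π ρ × (∀ k → Walk k π ρ → d ≤ k)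

_⊑?_ : (π ρ : NC n) → Dec (π ⊑ ρ)
π ⊑? ρ = Fin.all? λ i → Fin.any? λ j → block π i ⊆? block ρ j

_⊏?_ : (π ρ : NC n) → Dec (π ⊏ ρ)
π ⊏? ρ = (π ⊑? ρ) ×-dec ¬? (π ≟ᴺ ρ)

between? : (π ρ : NC n) → Dec (Σ (NC n) λ σ → π ⊏ σ × σ ⊏ ρ)
between? π ρ = exists? λ σ → (π ⊏? σ) ×-dec (σ ⊏? ρ)

_⋖?_ : (π ρ : NC n) → Dec (π ⋖ ρ)
π ⋖? ρ = (π ⊏? ρ) ×-dec ¬? (between? π ρ)

adjacent? : (π ρ : NC n) → Dec (Adjacent π ρ)
adjacent? π ρ = (π ⋖? ρ) ⊎-dec (ρ ⋖? π)

walk? : ∀ k (π ρ : NC n) → Dec (Walk k π ρ)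
walk? zero    π ρ = map′ (λ { refl → [] }) (λ { [] → refl }) (π ≟ᴺ ρ)
walk? (suc k) π ρ = map′ (λ (σ , e , w) → e ∷ w) (λ { (e ∷ w) → _ , e , w })
  (exists? λ σ → adjacent? π σ ×-dec walk? k σ ρ)

⊑⇒block⊆ : (π ρ : NC n) → π ⊑ ρ → ∀ i → block π i ⊆ block ρ i
⊑⇒block⊆ π ρ π⊑ρ i with π⊑ρ i
... | j , πi⊆ρj = subst (block π i ⊆_)
  (sym (ρ.coherent j i (πi⊆ρj (π.covers i)))) πi⊆ρj
  where
  module π = IsPartition (proj₁ (isNC π))
  module ρ = IsPartition (proj₁ (isNC ρ))

⊑-trans : {π σ ρ : NC n} → π ⊑ σ → σ ⊑ ρ → π ⊑ ρ
⊑-trans p q i with p i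
... | j , πi⊆σj with q j
... | l , σj⊆ρl = l , ⊆-trans πi⊆σj σj⊆ρl

⊑-antisym : {π ρ : NC n} → π ⊑ ρ → ρ ⊑ π → π ≡ ρ
⊑-antisym {π = π} {ρ} p q = value-injective (Pointwise-≡⇒≡ (ext λ i →
  ⊆-antisym (⊑⇒block⊆ π ρ p i) (⊑⇒block⊆ ρ π q i)))

⊏-trans : {π σ ρ : NC n} → π ⊏ σ → σ ⊏ ρ → π ⊏ ρ
⊏-trans {π = π} {σ} {ρ} (p , p≢) (q , _) =
  ⊑-trans {π = π} {σ} {ρ} p q , λ { refl → p≢ (⊑-antisym {π = π} {σ} p q) }

𝟙 : ∀ n → NC n
𝟙 n = replicate n ⊤ ,ᵣ [ isPartition
    (λ i → subst (i ∈_) (sym (lookup-replicate i ⊤)) ∈⊤)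
    (λ i j _ → trans (lookup-replicate j ⊤) (sym (lookup-replicate i ⊤)))
  , (λ (i , j , V≢W , _) →
      V≢W (trans (lookup-replicate i ⊤) (sym (lookup-replicate j ⊤)))) ]

⊑𝟙 : (π : NC n) → π ⊑ 𝟙 n
⊑𝟙 π i = i , subst (block π i ⊆_) (sym (lookup-replicate i ⊤)) ⊆⊤

-- Connectedness of the Hasse diagram: every element is joined to the top by a
-- saturated chain.

module _ {A : Set} {P Q : Pred A 0ℓ} (P? : Decidable P) (Q? : Decidable Q)
         (P⇒Q : ∀ {x} → P x → Q x) where

  count-≤ : ∀ xs → length (filter P? xs) ≤ length (filter Q? xs)
  count-≤ []       = z≤n
  count-≤ (x ∷ xs) with P? x | Q? x
  ... | yes p | yes q = s≤s (count-≤ xs)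
  ... | yes p | no ¬q = contradiction (P⇒Q p) ¬q
  ... | no ¬p | yes q = m≤n⇒m≤1+n (count-≤ xs)
  ... | no ¬p | no ¬q = count-≤ xs

  count-< : ∀ {y xs} → y ∈ₗ xs → Q y → ¬ P y →
            length (filter P? xs) < length (filter Q? xs)
  count-< {y} {x ∷ xs} y∈ qy ¬py with P? x | Q? x | y∈
  ... | yes p | _     | here refl = contradiction p ¬py
  ... | no ¬p | yes q | here refl = s≤s (count-≤ xs)
  ... | no ¬p | no ¬q | here refl = contradiction qy ¬q
  ... | yes p | yes q | there h   = s≤s (count-< h qy ¬py)
  ... | yes p | no ¬q | there h   = contradiction (P⇒Q p) ¬q
  ... | no ¬p | yes q | there h   = m≤n⇒m≤1+n (count-< h qy ¬py)
  ... | no ¬p | no ¬q | there h   = count-< h qy ¬py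

#above #below : NC n → ℕ
#above {n} π = length (filter (π ⊏?_) (allNC n))
#below {n} π = length (filter (_⊏? π) (allNC n))

#above-< : {π σ : NC n} → π ⊏ σ → #above σ < #above π
#above-< {π = π} {σ} π⊏σ = count-< (σ ⊏?_) (π ⊏?_)
  (λ {τ} → ⊏-trans {π = π} {σ} {τ} π⊏σ) (allNC-complete σ) π⊏σ (λ (_ , σ≢σ) → σ≢σ refl)

#below-< : {σ ρ : NC n} → σ ⊏ ρ → #below σ < #below ρ
#below-< {σ = σ} {ρ} σ⊏ρ = count-< (_⊏? σ) (_⊏? ρ)
  (λ {τ} τ⊏σ → ⊏-trans {π = τ} {σ} {ρ} τ⊏σ σ⊏ρ) (allNC-complete σ) σ⊏ρ (λ (_ , σ≢σ) → σ≢σ refl)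

∃-cover : {π ρ : NC n} → π ⊏ ρ → Acc _<_ (#below ρ) → ∃ λ σ → π ⋖ σ
∃-cover {π = π} {ρ} π⊏ρ (acc rs) with between? π ρ
... | no  none            = ρ , π⊏ρ , none
... | yes (σ , π⊏σ , σ⊏ρ) =
  ∃-cover {π = π} {σ} π⊏σ (rs (#below-< {σ = σ} {ρ} σ⊏ρ))

walk-to-𝟙 : (π : NC n) → Acc _<_ (#above π) → ∃ λ k → Walk k π (𝟙 n)
walk-to-𝟙 {n} π (acc rs) with π ≟ᴺ 𝟙 n
... | yes refl = 0 , []
... | no  π≢𝟙  with ∃-cover {π = π} {𝟙 n} (⊑𝟙 π , π≢𝟙) (<-wellFounded _)
... | σ , π⋖σ with walk-to-𝟙 σ (rs (#above-< {π = π} {σ} (proj₁ π⋖σ)))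
... | k , w = suc k , inj₁ π⋖σ ∷ w

reverseOnto : ∀ {k l} {π σ ρ : NC n} → Walk k σ π → Walk l σ ρ → ∃ λ m → Walk m π ρ
reverseOnto []      w = _ , w
reverseOnto (e ∷ v) w = reverseOnto v (swap e ∷ w)

append : ∀ {k l} {π σ ρ : NC n} → Walk k π σ → Walk l σ ρ → Walk (k + l) π ρ
append []      w = w
append (e ∷ v) w = e ∷ append v w

connected : (π ρ : NC n) → ∃ λ k → Walk k π ρ
connected π ρ with walk-to-𝟙 π (<-wellFounded _) | walk-to-𝟙 ρ (<-wellFounded _)
... | _ , v | _ , w with reverseOnto w []
... | _ , w⁻¹ = _ , append v w⁻¹

least : {P : Pred ℕ 0ℓ} → Decidable P → ∀ k → P k → ∃ λ m → P m × (∀ j → P j → m ≤ j)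
least P? zero    p = 0 , p , λ _ _ → z≤n
least P? (suc k) p with P? 0
... | yes p₀ = 0 , p₀ , λ _ _ → z≤n
... | no ¬p₀ with least (P? ∘ suc) k p
... | m , pm , min = suc m , pm , λ where
  zero    p₀ → contradiction p₀ ¬p₀
  (suc j) pj → s≤s (min j pj)

distance : (π ρ : NC n) → Σ ℕ (IsDistance π ρ)
distance π ρ with connected π ρ
... | k , w = least (λ k → walk? k π ρ) k w

d-H : NC n → NC n → ℕ
d-H π ρ = proj₁ (distance π ρ)

d-H-isDistance : (π ρ : NC n) → IsDistance π ρ (d-H π ρ)
d-H-isDistance π ρ = proj₂ (distance π ρ)

Cat : ℕ → ℚ
Cat n = (+ ((2 * n) !) / (n ! * suc n !)) {{m*n≢0 (n !) (suc n !) {{n !≢0}} {{suc n !≢0}}}}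

Cat-positive : ∀ n → ℚ.Positive (Cat n)
Cat-positive n = ℚ.normalize-pos ((2 * n) !) (n ! * suc n !)
  {{m*n≢0 (n !) (suc n !) {{n !≢0}} {{suc n !≢0}}}} {{(2 * n) !≢0}}

Cat²-nonZero : ∀ n → ℚ.NonZero (Cat n ℚ.* Cat n)
Cat²-nonZero n = ℚ.pos⇒nonZero (Cat n ℚ.* Cat n)
  {{ℚ.pos*pos⇒pos (Cat n) {{Cat-positive n}} (Cat n) {{Cat-positive n}}}}

{-# OPTIONS --safe #-}

-- A binary tree with n nodes, numbered in-order, yields two non-crossing
-- partitions: π_R, which joins each node to its right child, and π_L, which
-- joins each node to its left child.  Both determine the tree.  The tree has
-- n − 1 edges; if e_R of them are right and e_L are left, then e_R + e_L = n − 1.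
--
-- A cover relation of NC(n) merges two blocks, hence is generated by a single
-- pair.  On a walk from π_R to π_L with u steps up and v steps down, the right
-- edges together with the u pairs merged on the way connect everything, since
-- they generate π_R and π_L; so e_R + u ≥ n − 1.  Likewise e_L + v ≥ n − 1, and
-- adding up gives u + v ≥ n − 1, that is d(π_R, π_L) ≥ n − 1.
--
-- Now sum d(π_R, ρ) + d(ρ, π_L) ≥ n − 1 over all ρ and all trees.  There are
-- Cat_n trees, so |NC(n)| ≥ Cat_n and twice the sum of all distances is at
-- least Cat_n² (n − 1).

module Submission where

open import Defs
open import Data.Empty using (⊥)
open import Data.Fin as Fin using (Fin; zero; suc; toℕ; punchIn; punchOut)
import Data.Fin.Properties as Fin
open import Data.Fin.Subset using (Subset) renaming (_∈_ to _∈ˢ_)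
open import Data.Fin.Subset.Properties using (_∈?_)
import Data.Integer as ℤ
import Data.Integer.Properties as ℤ
open import Data.Irrelevant using ([_])
open import Data.List using (List; []; _∷_; _++_; map; length)
open import Data.List.Membership.Propositional using (_∈_)
open import Data.List.Membership.Propositional.Properties using (∈-map⁻; ∈-∃++; ∈-++⁻; ∈-++⁺ˡ; ∈-++⁺ʳ)
open import Data.List.Properties using (length-++; length-map) renaming (≡-dec to ≡-decᴸ)
open import Data.List.Relation.Unary.All as All using (All; []; _∷_)
import Data.List.Relation.Unary.All.Properties as All
open import Data.List.Relation.Unary.AllPairs using ([]; _∷_)
open import Data.List.Relation.Unary.Any using (here; there)
open import Data.List.Relation.Unary.Unique.Propositional using (Unique)
import Data.List.Relation.Unary.Unique.Propositional.Properties as Unique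
open import Data.Nat using (ℕ; zero; suc; _+_; _*_; _≤_; _<_; z≤n; s≤s; z<s; _!; NonZero)
open import Data.Nat.ListAction using (sum)
open import Data.Nat.Properties as ℕ
  using (<-trans; m<m+n; +-monoʳ-<; +-cancelˡ-<; +-cancelˡ-≡; suc-injective; _!≢0; m*n≢0)
open import Data.Nat.Tactic.RingSolver using (solve-∀)
open import Data.Product using (∃; ∃₂; _×_; _,_; proj₁; proj₂)
open import Data.Rational as ℚ using (_/_; _≥_; 1/_)
import Data.Rational.Properties as ℚ
import Data.Rational.Unnormalised as ℚᵘ
import Data.Rational.Unnormalised.Properties as ℚᵘ
open import Data.Refinement using () renaming (_,_ to _,ᵣ_)
open import Data.Sum using (_⊎_; inj₁; inj₂; [_,_]′)
open import Data.Vec as Vec using (Vec; []; _∷_; lookup; tabulate)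
import Data.Vec.Properties as Vec
open import Function using (_∘_; id; _⇔_; mk⇔; StrictlySurjective; case_of_)
open import Function.Bundles using (module Equivalence)
open import Relation.Binary.Definitions using (DecidableEquality; tri<; tri≈; tri>)
open import Relation.Binary.PropositionalEquality
open import Relation.Nullary using (¬_; Dec; yes; no; does; contradiction; ¬?)
open import Relation.Nullary.Decidable using (dec-true; _×-dec_; decidable-stable)

private
  variable
    n : ℕ

-- The two partitions of a binary tree

data Tree : Set where
  leaf : Tree
  node : Tree → Tree → Tree

size : Tree → ℕ
size leaf       = 0
size (node l r) = size l + suc (size r)

data Side : Set where
  L R : Side

-- The in-order positions of node l r, relative to m = size l: those of l, the
-- root, those of r.
data Region (m : ℕ) : ℕ → Set where
  left  : ∀ {i} → i < m → Region m i
  mid   : Region m m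
  right : ∀ j → Region m (m + suc j)

region : ∀ m i → Region m i
region zero    zero    = mid
region zero    (suc i) = right i
region (suc m) zero    = left z<s
region (suc m) (suc i) with region m i
... | left i<m = left (s≤s i<m)
... | mid      = mid
... | right j  = right j

-- `label` reduces only once `region` is known. The bound returned may be another proof of `i < m`;
-- `glue` ignores it.
region-left : ∀ {m i} → i < m → ∃ λ i<m → region m i ≡ left i<m
region-left {suc m} {zero}  _         = z<s , refl
region-left {suc m} {suc i} (s≤s i<m) with region m i | region-left i<m
... | _ | i<m′ , refl = s≤s i<m′ , refl

region-mid : ∀ m → region m m ≡ mid
region-mid zero    = refl
region-mid (suc m) rewrite region-mid m = refl

region-right : ∀ m j → region m (m + suc j) ≡ right j
region-right zero    j = refl
region-right (suc m) j rewrite region-right m j = refl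

glue : {A : Set} {m i : ℕ} → (ℕ → A) → A → (ℕ → A) → Region m i → A
glue {i = i} f a g (left _)  = f i
glue         f a g mid       = a
glue         f a g (right j) = g j

-- Labels of blocks: the address of the topmost node of the block, with the
-- steps along the chain of the given side dropped at the end; [] is the block
-- of the root.
Label : Set
Label = List Side

-- An empty label in a subtree stands for its root block. The chain on side `b` carries that block
-- on into the new root, so a step to side `b` leaves `[]` unchanged.
extend : (b s : Side) → Label → Label
extend L L []      = []
extend L L (x ∷ p) = L ∷ x ∷ p
extend L R p       = R ∷ p
extend R L p       = L ∷ p
extend R R []      = []
extend R R (x ∷ p) = R ∷ x ∷ p

extend-injective : ∀ b s {p q} → extend b s p ≡ extend b s q → p ≡ q
extend-injective L L {[]}    {[]}    eq   = refl
extend-injective L L {_ ∷ _} {_ ∷ _} refl = refl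
extend-injective L R                 refl = refl
extend-injective R L                 refl = refl
extend-injective R R {[]}    {[]}    eq   = refl
extend-injective R R {_ ∷ _} {_ ∷ _} refl = refl

extend-disjoint : ∀ b {p q} → extend b L p ≢ extend b R q
extend-disjoint L {[]}    ()
extend-disjoint L {_ ∷ _} ()
extend-disjoint R {q = []}    ()
extend-disjoint R {q = _ ∷ _} ()

extend-[] : ∀ b → extend b b [] ≡ []
extend-[] L = refl
extend-[] R = refl

-- label b t i is the block of position i in the partition of the nodes of t
-- that is generated by joining each node to its child on side b.
label : Side → Tree → ℕ → Label
label b leaf       i = []
label b (node l r) i =
  glue (extend b L ∘ label b l) [] (extend b R ∘ label b r) (region (size l) i)

module _ (b : Side) (l r : Tree) where

  label-left : ∀ {i} → i < size l → label b (node l r) i ≡ extend b L (label b l i)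
  label-left i<m rewrite proj₂ (region-left i<m) = refl

  label-mid : label b (node l r) (size l) ≡ []
  label-mid rewrite region-mid (size l) = refl

  label-right : ∀ j → label b (node l r) (size l + suc j) ≡ extend b R (label b r j)
  label-right j rewrite region-right (size l) j = refl

after : ∀ {m i} → m < i → ∃ λ j → i ≡ m + suc j
after {zero}  {suc i} _         = i , refl
after {suc m} {suc i} (s≤s m<i) with after m<i
... | j , refl = j , refl

m<m+1+j : ∀ m j → m < m + suc j
m<m+1+j m j = m<m+n m z<s

cancel-right : ∀ m {j k} → m + suc j < m + suc k → j < k
cancel-right m p = ℕ.≤-pred (+-cancelˡ-< m _ _ p)

-- The root block is not nested in another block, since its chain runs along
-- one side of the tree.
exposed : ∀ b t {i j k} → i < j → j < k → label b t j ≡ [] →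
          label b t i ≡ label b t k → label b t i ≡ []
exposed b leaf _ _ _ _ = refl
exposed b (node l r) {i} {j} {k} i<j j<k j≡ i≡k with region (size l) i
exposed b (node l r) i<j j<k j≡ i≡k | mid = refl
exposed b (node l r) {i} {j} {k} i<j j<k j≡ i≡k | left i<m with region (size l) k
exposed b (node l r) i<j j<k j≡ i≡k | left i<m | right k′ = contradiction i≡k (extend-disjoint b)
exposed b (node l r) i<j j<k j≡ i≡k | left i<m | mid = i≡k
exposed b (node l r) i<j j<k j≡ i≡k | left i<m | left k<m
  -- Now `j` lies in the left subtree as well. For `R` its label starts with `L`, so it is not in
  -- the root block; for `L` the claim descends to `l`.
  with trans (sym (label-left b l r (<-trans j<k k<m))) j≡
exposed R (node l r) i<j j<k j≡ i≡k | left i<m | left k<m | ()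
exposed L (node l r) i<j j<k j≡ i≡k | left i<m | left k<m | j≡′ =
  cong (extend L L) (exposed L l i<j j<k (extend-injective L L j≡′) (extend-injective L L i≡k))
exposed b (node l r) i<j j<k j≡ i≡k | right i′
  with after (<-trans (m<m+1+j (size l) i′) i<j)
     | after (<-trans (m<m+1+j (size l) i′) (<-trans i<j j<k))
... | j′ , refl | k′ , refl rewrite label-right b l r j′ | label-right b l r k′ with b
...   | L = contradiction j≡ λ ()
...   | R = cong (extend R R) (exposed R r (cancel-right (size l) i<j) (cancel-right (size l) j<k)
              (extend-injective R R j≡) (extend-injective R R i≡k))

NonCrossing : {A : Set} → (ℕ → A) → Set
NonCrossing f = ∀ {i j k l} → i < j → j < k → k < l → f i ≡ f k → f j ≡ f l → f i ≡ f j

-- Different subtrees have disjoint labels, and points of one subtree are left to the recursion. For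
-- `R` the root block lies at and after the root, so the leftmost point `a` decides the case; for
-- `L`, by symmetry, `d` does. When that point is the root, `exposed` applies in the subtree.
label-nonCrossing : ∀ b t → NonCrossing (label b t)
label-nonCrossing b leaf _ _ _ _ _ = refl
label-nonCrossing R (node l r) {a} {b} {c} {d} a<b b<c c<d a≡c b≡d with region (size l) a
... | left a<m with region (size l) c
...   | mid     = contradiction a≡c λ ()
...   | right _ = contradiction a≡c (extend-disjoint R)
...   | left c<m with region (size l) d
...     | left d<m rewrite label-left R l r (<-trans b<c c<m) =
            cong (extend R L) (label-nonCrossing R l a<b b<c c<d (extend-injective R L a≡c) (extend-injective R L b≡d))
...     | mid rewrite label-left R l r (<-trans b<c c<m) = contradiction b≡d λ ()
...     | right _ rewrite label-left R l r (<-trans b<c c<m) = contradiction b≡d (extend-disjoint R)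
label-nonCrossing R (node l r) {a} {b} {c} {d} a<b b<c c<d a≡c b≡d | mid
  with after a<b | after (<-trans a<b b<c) | after (<-trans a<b (<-trans b<c c<d))
... | b′ , refl | c′ , refl | d′ , refl
  rewrite label-right R l r b′ | label-right R l r c′ | label-right R l r d′ =
    sym (cong (extend R R) (exposed R r (cancel-right (size l) b<c) (cancel-right (size l) c<d)
      (extend-injective R R (sym a≡c)) (extend-injective R R b≡d)))
label-nonCrossing R (node l r) {a} {b} {c} {d} a<b b<c c<d a≡c b≡d | right a′
  with m<a ← m<m+1+j (size l) a′
  with after (<-trans m<a a<b) | after (<-trans m<a (<-trans a<b b<c))
     | after (<-trans m<a (<-trans a<b (<-trans b<c c<d)))
... | b′ , refl | c′ , refl | d′ , refl
  rewrite label-right R l r b′ | label-right R l r c′ | label-right R l r d′ =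
    cong (extend R R) (label-nonCrossing R r (cancel-right (size l) a<b) (cancel-right (size l) b<c)
      (cancel-right (size l) c<d) (extend-injective R R a≡c) (extend-injective R R b≡d))
label-nonCrossing L (node l r) {a} {b} {c} {d} a<b b<c c<d a≡c b≡d with region (size l) d
... | left d<m
  rewrite label-left L l r (<-trans c<d d<m) | label-left L l r (<-trans b<c (<-trans c<d d<m))
        | label-left L l r (<-trans a<b (<-trans b<c (<-trans c<d d<m))) =
    cong (extend L L) (label-nonCrossing L l a<b b<c c<d (extend-injective L L a≡c) (extend-injective L L b≡d))
... | mid
  rewrite label-left L l r c<d | label-left L l r (<-trans b<c c<d)
        | label-left L l r (<-trans a<b (<-trans b<c c<d)) =
    trans (cong (extend L L) (exposed L l a<b b<c (extend-injective L L b≡d) (extend-injective L L a≡c))) (sym b≡d)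
... | right d′ with region (size l) b
...   | left _ = contradiction b≡d (extend-disjoint L)
...   | mid    = contradiction b≡d λ ()
...   | right b′ with after (<-trans (m<m+1+j (size l) b′) b<c)
...     | c′ , refl rewrite label-right L l r c′ with region (size l) a
...       | left _   = contradiction a≡c (extend-disjoint L)
...       | mid      = contradiction a≡c λ ()
...       | right a′ = cong (extend L R) (label-nonCrossing L r (cancel-right (size l) a<b) (cancel-right (size l) b<c)
                         (cancel-right (size l) c<d) (extend-injective L R a≡c) (extend-injective L R b≡d))

-- A position in the block of the root that depends only on the size of the tree.
anchor : Side → Tree → ℕ
anchor L t                     = 0
anchor R leaf                  = 0
anchor R (node l leaf)         = size l
anchor R (node l r@(node _ _)) = size l + suc (anchor R r)

-- The path of right children from the root ends at the last node of the in-order, so the anchor for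
-- `R` is the final position.
suc-anchor : ∀ l r → suc (anchor R (node l r)) ≡ size (node l r)
suc-anchor l leaf           = ℕ.+-comm 1 (size l)
suc-anchor l r@(node a c)   = trans (cong suc (cong (size l +_) (suc-anchor a c))) (sym (ℕ.+-suc (size l) (size r)))

anchor-< : ∀ b t {k} → k < size t → anchor b t < size t
anchor-< L t k<t          = ℕ.≤-<-trans z≤n k<t
anchor-< R (node l r) _ = ℕ.≤-reflexive (suc-anchor l r)

anchor-cong : ∀ b t t′ → size t ≡ size t′ → anchor b t ≡ anchor b t′
anchor-cong L _ _ _ = refl
anchor-cong R leaf leaf _ = refl
anchor-cong R leaf (node l r) eq = contradiction (trans eq (ℕ.+-suc (size l) (size r))) λ ()
anchor-cong R (node l r) leaf eq = contradiction (trans (sym eq) (ℕ.+-suc (size l) (size r))) λ ()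
anchor-cong R (node l r) (node l′ r′) eq =
  suc-injective (trans (suc-anchor l r) (trans eq (sym (suc-anchor l′ r′))))

label-anchor : ∀ b t → label b t (anchor b t) ≡ []
label-anchor b leaf = refl
label-anchor L (node leaf r) = refl
label-anchor L (node l@(node a c) r) =
  trans (label-left L l r (ℕ.≤-<-trans z≤n (m<m+1+j (size a) _))) (cong (extend L L) (label-anchor L l))
label-anchor R (node l leaf) = label-mid R l leaf
label-anchor R (node l r@(node _ _)) =
  trans (label-right R l r (anchor R r)) (cong (extend R R) (label-anchor R r))

-- Recovering a tree from one of its partitions

SameKernel : {A B : Set} → ℕ → (ℕ → A) → (ℕ → B) → Set
SameKernel n f g = ∀ {i j} → i < n → j < n → f i ≡ f j ⇔ g i ≡ g j

SameKernel-sym : ∀ {A B : Set} {n} {f : ℕ → A} {g : ℕ → B} → SameKernel n f g → SameKernel n g f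
SameKernel-sym k i< j< = mk⇔ (from (k i< j<)) (to (k i< j<))
  where open Equivalence

-- The root is the extreme element, on the side opposite to the chain, of the
-- block of the anchor.
rootPosition-≤ : ∀ b l r l′ r′ → size (node l r) ≡ size (node l′ r′) →
  SameKernel (size (node l r)) (label b (node l r)) (label b (node l′ r′)) → size l′ ≤ size l
rootPosition-≤ b l r l′ r′ eq k = ℕ.≮⇒≥ (separated b k)
  where
  t  = node l r
  t′ = node l′ r′
  l<t : size l < size t
  l<t = m<m+1+j (size l) (size r)
  l′<t : size l′ < size t
  l′<t = subst (size l′ <_) (sym eq) (m<m+1+j (size l′) (size r′))
  anchor′ : ∀ b → label b t′ (anchor b t) ≡ []
  anchor′ b = trans (cong (label b t′) (anchor-cong b t t′ eq)) (label-anchor b t′)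
  separated : ∀ b → SameKernel (size t) (label b t) (label b t′) → ¬ size l < size l′
  -- The root of `t` shares its block with the last position, which is in the root block of `t′`
  -- too; but in `t′` it lies in the left subtree, where `R`-labels start with `L`.
  separated R k l<l′ = contradiction
    (trans (sym (label-left R l′ r′ l<l′)) (trans (Equivalence.to (k l<t (anchor-< R t l<t))
      (trans (label-mid R l r) (sym (label-anchor R t)))) (anchor′ R)))
    λ ()
  -- Conversely the root of `t′` shares its block with position 0, although in `t` it lies in the
  -- right subtree, where `L`-labels start with `R`.
  separated L k l<l′ with j , l′≡ ← after l<l′ = contradiction
    (trans (sym (label-right L l r j)) (trans (cong (label L t) (sym l′≡))
      (trans (Equivalence.from (k l′<t (anchor-< L t l<t))
        (trans (label-mid L l′ r′) (sym (anchor′ L)))) (label-anchor L t))))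
    λ ()

-- `rootPosition-≤` in both directions fixes the position of the root and so the sizes of both
-- subtrees. As `extend b s` is injective, the kernels restrict to the subtrees.
label-injective : ∀ b t t′ → size t ≡ size t′ →
                  SameKernel (size t) (label b t) (label b t′) → t ≡ t′
label-injective b leaf leaf _ _ = refl
label-injective b leaf (node l r) eq = contradiction (trans eq (ℕ.+-suc (size l) (size r))) λ ()
label-injective b (node l r) leaf eq = contradiction (trans (sym eq) (ℕ.+-suc (size l) (size r))) λ ()
label-injective b (node l r) (node l′ r′) eq k =
  cong₂ node (label-injective b l l′ l≡l′ kˡ) (label-injective b r r′ r≡r′ kʳ)
  where
  t  = node l r
  t′ = node l′ r′
  k′ : SameKernel (size t′) (label b t′) (label b t)
  k′ = subst (λ n → SameKernel n (label b t′) (label b t)) eq (SameKernel-sym k)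
  l≡l′ : size l ≡ size l′
  l≡l′ = ℕ.≤-antisym (rootPosition-≤ b l′ r′ l r (sym eq) k′) (rootPosition-≤ b l r l′ r′ eq k)
  r≡r′ : size r ≡ size r′
  r≡r′ = suc-injective (+-cancelˡ-≡ (size l) _ _ (trans eq (cong (_+ suc (size r′)) (sym l≡l′))))
  left′ : ∀ {i} → i < size l → label b t′ i ≡ extend b L (label b l′ i)
  left′ i< = label-left b l′ r′ (subst (_ <_) l≡l′ i<)
  right′ : ∀ j → label b t′ (size l + suc j) ≡ extend b R (label b r′ j)
  right′ j = trans (cong (λ m → label b t′ (m + suc j)) l≡l′) (label-right b l′ r′ j)
  transport : ∀ {s x y x′ y′ p q p′ q′} → label b t x ≡ extend b s p → label b t y ≡ extend b s q →
    label b t′ x′ ≡ extend b s p′ → label b t′ y′ ≡ extend b s q′ →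
    label b t x ≡ label b t y ⇔ label b t′ x′ ≡ label b t′ y′ → p ≡ q ⇔ p′ ≡ q′
  transport {s} x≡ y≡ x′≡ y′≡ e = mk⇔
    (λ { refl → extend-injective b s (trans (sym x′≡) (trans (Equivalence.to e (trans x≡ (sym y≡))) y′≡)) })
    (λ { refl → extend-injective b s (trans (sym x≡) (trans (Equivalence.from e (trans x′≡ (sym y′≡))) y≡)) })
  kˡ : SameKernel (size l) (label b l) (label b l′)
  kˡ i< j< = transport (label-left b l r i<) (label-left b l r j<) (left′ i<) (left′ j<)
    (k (<-trans i< l<t) (<-trans j< l<t))
    where l<t = m<m+1+j (size l) (size r)
  kʳ : SameKernel (size r) (label b r) (label b r′)
  kʳ {i} {j} i< j< = transport (label-right b l r i) (label-right b l r j) (right′ i) (right′ j)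
    (k (+-monoʳ-< (size l) (s≤s i<)) (+-monoʳ-< (size l) (s≤s j<)))

-- Tree edges as generators of the two partitions

Edge : Set → Set
Edge A = A × A

Joins : {A B : Set} → (A → B) → Edge A → Set
Joins f (x , y) = f x ≡ f y

-- The edge to a child ends at the anchor of the child's subtree, which lies in the child's block,
-- so the partition generated is the same.
link : Side → Tree → Tree → List (Edge ℕ)
link L leaf         r            = []
link L l@(node _ _) r            = (size l , anchor L l) ∷ []
link R l            leaf         = []
link R l            r@(node _ _) = (size l , size l + suc (anchor R r)) ∷ []

shift : ℕ → Edge ℕ → Edge ℕ
shift m (i , j) = m + suc i , m + suc j

edges : Side → Tree → List (Edge ℕ)
edges b leaf       = []
edges b (node l r) = link b l r ++ edges b l ++ map (shift (size l)) (edges b r)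

#edges : Tree → ℕ
#edges t = length (edges L t) + length (edges R t)

#edges-node : ∀ l r → suc (#edges (node l r)) ≡ size (node l r)
#edges-node l r = begin
  suc (#edges (node l r))
    ≡⟨ cong suc (cong₂ _+_ (length-edges L) (length-edges R)) ⟩
  suc ((length (link L l r) + (length (edges L l) + length (edges L r)))
     + (length (link R l r) + (length (edges R l) + length (edges R r))))
    ≡⟨ rearrange (length (link L l r)) (length (edges L l)) (length (edges L r))
                 (length (link R l r)) (length (edges R l)) (length (edges R r)) ⟩
  (length (link L l r) + #edges l) + suc (length (link R l r) + #edges r)
    ≡⟨ cong₂ (λ x y → x + suc y) (left-size l) (right-size r) ⟩
  size (node l r) ∎
  where
  open ≡-Reasoning
  length-edges : ∀ b → length (edges b (node l r)) ≡
                       length (link b l r) + (length (edges b l) + length (edges b r))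
  length-edges b = trans (length-++ (link b l r)) (cong (length (link b l r) +_)
    (trans (length-++ (edges b l)) (cong (length (edges b l) +_) (length-map (shift (size l)) (edges b r)))))
  rearrange : ∀ a c d e f g → suc ((a + (c + d)) + (e + (f + g))) ≡ (a + (c + f)) + suc (e + (d + g))
  rearrange = solve-∀
  -- The link to a nonempty subtree makes up for the one edge that the subtree falls short of its
  -- size.
  left-size : ∀ l → length (link L l r) + #edges l ≡ size l
  left-size leaf       = refl
  left-size (node a c) = #edges-node a c
  right-size : ∀ r → length (link R l r) + #edges r ≡ size r
  right-size leaf       = refl
  right-size (node a c) = #edges-node a c

Respects : {A B : Set} → ℕ → (ℕ → A) → (ℕ → B) → Set
Respects n f g = ∀ {i j} → i < n → j < n → f i ≡ f j → g i ≡ g j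

-- A point of the root block other than the root lies in the subtree on side `b`, in the block of
-- its anchor, and the link leads from there to the root.
root-joined : ∀ {A : Set} b l r (g : ℕ → A) → All (Joins g) (link b l r) →
  Respects (size l) (label b l) g → Respects (size r) (label b r) (g ∘ (size l +_) ∘ suc) →
  ∀ {i} → i < size (node l r) → label b (node l r) i ≡ [] → g i ≡ g (size l)
root-joined b l r g g-link gˡ gʳ {i} i<t i≡ with region (size l) i
root-joined b l r g g-link gˡ gʳ i<t i≡ | mid = refl
root-joined L l@(node _ _) r g (g-link ∷ []) gˡ gʳ i<t i≡ | left i<l =
  trans (gˡ i<l (anchor-< L l i<l) (trans (extend-injective L L i≡) (sym (label-anchor L l)))) (sym g-link)
root-joined R l r@(node _ _) g (g-link ∷ []) gˡ gʳ i<t i≡ | right j =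
  trans (gʳ j<r (anchor-< R r j<r) (trans (extend-injective R R i≡) (sym (label-anchor R r)))) (sym g-link)
  where j<r = cancel-right (size l) i<t
root-joined L l leaf g g-link gˡ gʳ i<t () | right j
root-joined L l (node _ _) g g-link gˡ gʳ i<t () | right j
root-joined R l leaf g g-link gˡ gʳ i<t i≡ | right j = contradiction (cancel-right (size l) i<t) λ ()

edges-generate : ∀ {A : Set} b t (g : ℕ → A) → All (Joins g) (edges b t) →
                 Respects (size t) (label b t) g
edges-generate b (node l r) g g-edges {i} {j} i<t j<t i≡j = by-region (region (size l) i) (region (size l) j) refl refl
  where
  m = size l
  gˡ : Respects m (label b l) g
  gˡ = edges-generate b l g (All.++⁻ˡ (edges b l) (All.++⁻ʳ (link b l r) g-edges))
  gʳ : Respects (size r) (label b r) (g ∘ (m +_) ∘ suc)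
  gʳ = edges-generate b r (g ∘ (m +_) ∘ suc)
         (All.map⁻ (All.++⁻ʳ (edges b l) (All.++⁻ʳ (link b l r) g-edges)))
  to-root : ∀ {i} → i < size (node l r) → label b (node l r) i ≡ [] → g i ≡ g m
  to-root = root-joined b l r g (All.++⁻ˡ (link b l r) g-edges) gˡ gʳ
  by-region : ∀ {i′ j′} → Region m i′ → Region m j′ → i′ ≡ i → j′ ≡ j → g i ≡ g j
  by-region (left i<m) (left j<m) refl refl = gˡ i<m j<m
    (extend-injective b L (trans (sym (label-left b l r i<m)) (trans i≡j (label-left b l r j<m))))
  by-region mid _ refl _ = sym (to-root j<t (trans (sym i≡j) (label-mid b l r)))
  by-region _ mid _ refl = to-root i<t (trans i≡j (label-mid b l r))
  by-region (right i′) (right j′) refl refl = gʳ (cancel-right m i<t) (cancel-right m j<t)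
    (extend-injective b R (trans (sym (label-right b l r i′)) (trans i≡j (label-right b l r j′))))
  by-region (left i<m) (right j′) refl refl = contradiction
    (trans (sym (label-left b l r i<m)) (trans i≡j (label-right b l r j′))) (extend-disjoint b)
  by-region (right i′) (left j<m) refl refl = contradiction
    (trans (sym (label-left b l r j<m)) (trans (sym i≡j) (label-right b l r i′))) (extend-disjoint b)

-- Each subtree is connected by recursion. The left one is attached to the root by the
-- `L`-partition, the right one by the `R`-partition, each through its anchor.
jointly-connected : ∀ {A : Set} t (g : ℕ → A) → (∀ b → Respects (size t) (label b t) g) →
                    ∀ {i j} → i < size t → j < size t → g i ≡ g j
jointly-connected (node l r) g g-resp = λ i< j< → trans (to-root i<) (sym (to-root j<))
  where
  t = node l r
  l<t : size l < size t
  l<t = m<m+1+j (size l) (size r)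
  left-const : ∀ {i j} → i < size l → j < size l → g i ≡ g j
  left-const = jointly-connected l g λ b i< j< i≡j → g-resp b (<-trans i< l<t) (<-trans j< l<t)
    (trans (label-left b l r i<) (trans (cong (extend b L) i≡j) (sym (label-left b l r j<))))
  right-const : ∀ {i j} → i < size r → j < size r → g (size l + suc i) ≡ g (size l + suc j)
  right-const = jointly-connected r (g ∘ (size l +_) ∘ suc) λ b {i} {j} i< j< i≡j →
    g-resp b (+-monoʳ-< (size l) (s≤s i<)) (+-monoʳ-< (size l) (s≤s j<))
    (trans (label-right b l r i) (trans (cong (extend b R) i≡j) (sym (label-right b l r j))))
  to-root : ∀ {i} → i < size t → g i ≡ g (size l)
  to-root {i} i<t with region (size l) i
  ... | left i<l = trans (left-const i<l a<l) (g-resp L (<-trans a<l l<t) l<t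
          (trans (label-left L l r a<l) (trans (cong (extend L L) (label-anchor L l)) (sym (label-mid L l r)))))
    where a<l = anchor-< L l i<l
  ... | mid     = refl
  ... | right j = trans (right-const j<r a<r) (g-resp R (+-monoʳ-< (size l) (s≤s a<r)) l<t
          (trans (label-right R l r _) (trans (cong (extend R R) (label-anchor R r)) (sym (label-mid R l r)))))
    where
    j<r = cancel-right (size l) i<t
    a<r = anchor-< R r j<r

-- Merging blocks

Same : NC n → Fin n → Fin n → Set
Same π i j = j ∈ˢ block π i

same? : (π : NC n) → ∀ i j → Dec (Same π i j)
same? π i j = j ∈? block π i

module _ (π : NC n) where

  open IsPartition (proj₁ (isNC π))

  same⇒block≡ : ∀ {i j} → Same π i j → block π i ≡ block π j
  same⇒block≡ {i} {j} p = sym (coherent i j p)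

  block≡⇒same : ∀ {i j} → block π i ≡ block π j → Same π i j
  block≡⇒same {i} {j} eq = subst (j ∈ˢ_) (sym eq) (covers j)

  same-refl : ∀ {i} → Same π i i
  same-refl {i} = covers i

  same-sym : ∀ {i j} → Same π i j → Same π j i
  same-sym = block≡⇒same ∘ sym ∘ same⇒block≡

  same-trans : ∀ {i j k} → Same π i j → Same π j k → Same π i k
  same-trans p q = block≡⇒same (trans (same⇒block≡ p) (same⇒block≡ q))

  same-nonCrossing : ∀ {a b c d} → a Fin.< b → b Fin.< c → c Fin.< d →
                     Same π a c → Same π b d → Same π a b
  same-nonCrossing {a} {b} a<b b<c c<d ac bd with block π a ≟ˢ block π b
  ... | yes eq = block≡⇒same eq
  ... | no ≢   = contradiction
    (a , b , ≢ , _ , _ , _ , _ , (a<b , b<c , c<d) , (same-refl , ac) , (same-refl , bd))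
    (proj₂ (isNC π))

Same⊆⇒⊑ : (π ρ : NC n) → (∀ {i j} → Same π i j → Same ρ i j) → π ⊑ ρ
Same⊆⇒⊑ π ρ h i = i , h

-- Non-crossing partitions as kernels of functions

module _ {A : Set} (_≟_ : DecidableEquality A) where

  kernelMap : (Fin n → A) → BlockMap n
  kernelMap f = tabulate λ i → tabulate λ j → does (f i ≟ f j)

  module _ (f : Fin n → A) where

    private
      lookup-kernelMap : ∀ i → lookup (kernelMap f) i ≡ tabulate λ j → does (f i ≟ f j)
      lookup-kernelMap = Vec.lookup∘tabulate _

    ∈-kernelMap⁺ : ∀ {i j} → f i ≡ f j → j ∈ˢ lookup (kernelMap f) i
    ∈-kernelMap⁺ {i} {j} eq = subst (j ∈ˢ_) (sym (lookup-kernelMap i))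
      (Vec.lookup⇒[]= j _ (trans (Vec.lookup∘tabulate _ j) (dec-true (f i ≟ f j) eq)))

    ∈-kernelMap⁻ : ∀ {i j} → j ∈ˢ lookup (kernelMap f) i → f i ≡ f j
    ∈-kernelMap⁻ {i} {j} j∈ with f i ≟ f j in eq
    ... | yes p = p
    ... | no _  = contradiction
      (trans (sym (trans (Vec.lookup∘tabulate (λ j → does (f i ≟ f j)) j) (cong does eq)))
             (Vec.[]=⇒lookup (subst (j ∈ˢ_) (lookup-kernelMap i) j∈)))
      λ ()

    kernelMap-cong : ∀ {i j} → f i ≡ f j → lookup (kernelMap f) i ≡ lookup (kernelMap f) j
    kernelMap-cong {i} {j} eq = trans (lookup-kernelMap i)
      (trans (cong (λ x → tabulate λ k → does (x ≟ f k)) eq) (sym (lookup-kernelMap j)))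

    kernel : (∀ {a b c d} → a Fin.< b → b Fin.< c → c Fin.< d → f a ≡ f c → f b ≡ f d → f a ≡ f b) → NC n
    kernel nc = kernelMap f ,ᵣ [ isPartition (λ i → ∈-kernelMap⁺ refl)
        (λ i j j∈ → kernelMap-cong (sym (∈-kernelMap⁻ j∈)))
      , (λ (i , j , V≢W , a , b , c , d , (a<b , b<c , c<d) , (a∈ , c∈) , (b∈ , d∈)) →
          let ia = ∈-kernelMap⁻ a∈ ; jb = ∈-kernelMap⁻ b∈ in
          V≢W (kernelMap-cong (trans ia (trans
            (nc a<b b<c c<d (trans (sym ia) (∈-kernelMap⁻ c∈)) (trans (sym jb) (∈-kernelMap⁻ d∈)))
            (sym jb))))) ]

data Position (x y e : Fin n) : Set where
  endpoint : e ≡ x ⊎ e ≡ y → Position x y e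
  inside   : x Fin.< e → e Fin.< y → Position x y e
  outside  : e Fin.< x ⊎ y Fin.< e → Position x y e

position : (x y e : Fin n) → Position x y e
position x y e with Fin.<-cmp e x | Fin.<-cmp e y
... | tri< e<x _ _ | _            = outside (inj₁ e<x)
... | tri≈ _ e≡x _ | _            = endpoint (inj₁ e≡x)
... | tri> _ _ x<e | tri< e<y _ _ = inside x<e e<y
... | tri> _ _ _   | tri≈ _ e≡y _ = endpoint (inj₂ e≡y)
... | tri> _ _ _   | tri> _ _ y<e = outside (inj₂ y<e)

-- The pairs `x`, `y` and `p`, `q` interleave, so non-crossing forces all four points into one
-- block.
chord-same : (π : NC n) → ∀ {x y p q} → Same π x y → x Fin.< p → p Fin.< y → q Fin.< x ⊎ y Fin.< q →
             Same π p q → Same π x p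
chord-same π xy x<p p<y (inj₁ q<x) pq =
  same-trans π (same-sym π (same-nonCrossing π q<x x<p p<y (same-sym π pq) xy)) (same-sym π pq)
chord-same π xy x<p p<y (inj₂ y<q) pq = same-nonCrossing π x<p p<y y<q xy pq

Constant : {A : Set} → NC n → (Fin n → A) → Set
Constant π f = ∀ {i j} → Same π i j → f i ≡ f j

-- ρ is contained in the equivalence relation generated by π and the pairs in E,
-- expressed through the functions that are constant on classes.
Generates : NC n → List (Edge (Fin n)) → NC n → Set₁
Generates {n} π E ρ = ∀ {A : Set} (f : Fin n → A) → Constant π f → All (Joins f) E → Constant ρ f

-- Constructs a partition between `π` and `σ` by uniting the `π`-blocks of `i` and `j`. Taking `i`
-- and `j` consecutive in their `σ`-block is what keeps the union non-crossing.
module Merge (π σ : NC n) (π⊆σ : ∀ {x y} → Same π x y → Same σ x y)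
             {i j : Fin n} (σij : Same σ i j) (i<j : i Fin.< j)
             (consecutive : ∀ {k} → i Fin.< k → k Fin.< j → ¬ Same σ i k) where

  Merged : Fin n → Set
  Merged x = Same π i x ⊎ Same π j x

  f : Fin n → Subset n
  f x with same? π j x
  ... | yes _ = block π i
  ... | no  _ = block π x

  f≡⁻ : ∀ {x y} → f x ≡ f y → Same π x y ⊎ Merged x × Merged y
  f≡⁻ {x} {y} eq with same? π j x | same? π j y
  ... | yes p | yes q = inj₂ (inj₂ p , inj₂ q)
  ... | yes p | no  _ = inj₂ (inj₂ p , inj₁ (block≡⇒same π eq))
  ... | no  _ | yes q = inj₂ (inj₁ (block≡⇒same π (sym eq)) , inj₂ q)
  ... | no  _ | no  _ = inj₁ (block≡⇒same π eq)

  f-merged : ∀ {x} → Merged x → f x ≡ block π i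
  f-merged {x} m with same? π j x | m
  ... | yes _ | _      = refl
  ... | no _  | inj₁ p = sym (same⇒block≡ π p)
  ... | no ¬q | inj₂ q = contradiction q ¬q

  f-same : ∀ {x y} → Same π x y → f x ≡ f y
  f-same {x} {y} p with same? π j x | same? π j y
  ... | yes q | yes _ = refl
  ... | yes q | no ¬q = contradiction (same-trans π q p) ¬q
  ... | no ¬q | yes q = contradiction (same-trans π q (same-sym π p)) ¬q
  ... | no _  | no _  = same⇒block≡ π p

  merged⇒σ : ∀ {x} → Merged x → Same σ i x
  merged⇒σ (inj₁ p) = π⊆σ p
  merged⇒σ (inj₂ p) = same-trans σ σij (π⊆σ p)

  f≡⇒σ : ∀ {x y} → f x ≡ f y → Same σ x y
  f≡⇒σ eq with f≡⁻ eq
  ... | inj₁ p       = π⊆σ p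
  ... | inj₂ (p , q) = same-trans σ (same-sym σ (merged⇒σ p)) (merged⇒σ q)

  -- A chord of π that separates merged elements ends in a merged element: i and
  -- j are on the same side of it, so π joins elements on different sides.
  chord-merged : ∀ {x y p q} → Same π x y → x Fin.< p → p Fin.< y → q Fin.< x ⊎ y Fin.< q →
                 Merged p → Merged q → Merged x
  chord-merged {x} {y} {p} {q} xy x<p p<y q-out mp mq = by-position mp mq (position x y i) (position x y j)
    where
    -- In `σ` the points `p` and `q` share a block, and their chord crosses the one from `x` to `y`,
    -- so all four lie in the `σ`-block of `i`.
    σix : Same σ i x
    σix = same-trans σ (merged⇒σ mp) (same-sym σ (chord-same σ (π⊆σ xy) x<p p<y q-out
      (same-trans σ (same-sym σ (merged⇒σ mp)) (merged⇒σ mq))))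
    σiy : Same σ i y
    σiy = same-trans σ σix (π⊆σ xy)
    via-p : ∀ {e} → Same π e p → e Fin.< x ⊎ y Fin.< e → Same π e x
    via-p ep e-out = same-trans π ep (same-sym π (chord-same π xy x<p p<y e-out (same-sym π ep)))
    via-q : ∀ {e} → Same π e q → x Fin.< e → e Fin.< y → Same π e x
    via-q eq x<e e<y = same-sym π (chord-same π xy x<e e<y q-out eq)
    at-endpoint : ∀ {e} → e ≡ x ⊎ e ≡ y → Same π e x
    at-endpoint (inj₁ refl) = same-refl π
    at-endpoint (inj₂ refl) = same-sym π xy
    by-position : Merged p → Merged q → Position x y i → Position x y j → Merged x
    by-position _ _ (endpoint i-end) _ = inj₁ (at-endpoint i-end)
    by-position _ _ _ (endpoint j-end) = inj₂ (at-endpoint j-end)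
    -- If the partner of `p` or `q` among `i` and `j` lies on the other side of the chord, the two
    -- `π`-chords cross and the partner's block contains `x`.
    by-position _ (inj₁ iq) (inside x<i i<y) _ = inj₁ (via-q iq x<i i<y)
    by-position _ (inj₂ jq) _ (inside x<j j<y) = inj₂ (via-q jq x<j j<y)
    by-position (inj₁ ip) _ (outside i-out) _ = inj₁ (via-p ip i-out)
    by-position (inj₂ jp) _ _ (outside j-out) = inj₂ (via-p jp j-out)
    -- A chord separating `i` from `j` would have an end strictly between them in their `σ`-block,
    -- or would reverse their order.
    by-position _ _ (inside x<i i<y) (outside (inj₁ j<x)) = contradiction (<-trans j<x x<i) (ℕ.<-asym i<j)
    by-position _ _ (inside x<i i<y) (outside (inj₂ y<j)) = contradiction σiy (consecutive i<y y<j)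
    by-position _ _ (outside (inj₁ i<x)) (inside x<j j<y) = contradiction σix (consecutive i<x x<j)
    by-position _ _ (outside (inj₂ y<i)) (inside x<j j<y) = contradiction (<-trans j<y y<i) (ℕ.<-asym i<j)

  nonCrossing : ∀ {a b c d} → a Fin.< b → b Fin.< c → c Fin.< d → f a ≡ f c → f b ≡ f d → f a ≡ f b
  nonCrossing {a} {b} {c} {d} a<b b<c c<d ac bd with f≡⁻ ac | f≡⁻ bd
  ... | inj₁ p | inj₁ q = f-same (same-nonCrossing π a<b b<c c<d p q)
  ... | inj₂ (ma , _) | inj₂ (mb , _) = trans (f-merged ma) (sym (f-merged mb))
  ... | inj₂ (ma , mc) | inj₁ q = trans (f-merged ma) (sym (f-merged (chord-merged q b<c c<d (inj₁ a<b) mc ma)))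
  ... | inj₁ p | inj₂ (mb , md) = trans (f-merged (chord-merged p a<b b<c (inj₂ c<d) mb md)) (sym (f-merged mb))

  merged : NC n
  merged = kernel _≟ˢ_ f nonCrossing

  same-merged⁺ : ∀ {x y} → f x ≡ f y → Same merged x y
  same-merged⁺ = ∈-kernelMap⁺ _≟ˢ_ f

  same-merged⁻ : ∀ {x y} → Same merged x y → f x ≡ f y
  same-merged⁻ = ∈-kernelMap⁻ _≟ˢ_ f

  merged-generated : ∀ {A : Set} (h : Fin n → A) → Constant π h → h i ≡ h j → Constant merged h
  merged-generated h h-π h-ij {x} {y} xy with f≡⁻ (same-merged⁻ xy)
  ... | inj₁ πxy       = h-π πxy
  ... | inj₂ (mx , my) = trans (sym (to-i mx)) (to-i my)
    where
    to-i : ∀ {z} → Merged z → h i ≡ h z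
    to-i (inj₁ p) = h-π p
    to-i (inj₂ p) = trans h-ij (h-π p)

  ⊏merged : ¬ Same π i j → π ⊏ merged
  ⊏merged ¬πij = Same⊆⇒⊑ π merged (λ p → same-merged⁺ (f-same p)) , λ π≡ → ¬πij (subst (λ ρ → Same ρ i j) (sym π≡)
    (same-merged⁺ (trans (f-merged (inj₁ (same-refl π))) (sym (f-merged (inj₂ (same-refl π)))))))

  merged⊑ : merged ⊑ σ
  merged⊑ = Same⊆⇒⊑ merged σ (λ p → f≡⇒σ (same-merged⁻ p))

-- Cover relations as merges along one pair

⋖⇒≡ : {π σ τ : NC n} → π ⋖ σ → π ⊏ τ → τ ⊑ σ → τ ≡ σ
⋖⇒≡ {σ = σ} {τ} (_ , none) π⊏τ τ⊑σ = decidable-stable (τ ≟ᴺ σ) λ τ≢σ → none (τ , π⊏τ , τ⊑σ , τ≢σ)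

-- Descent on a bound `g` for the gap. An intermediate `k` in the `σ`-block splits the pair in two,
-- and `π` must separate one of the halves.
consecutive-pair : (π σ : NC n) → ∀ g {i j} → toℕ j ≤ g + toℕ i → i Fin.< j → Same σ i j → ¬ Same π i j →
  ∃₂ λ i j → i Fin.< j × Same σ i j × ¬ Same π i j × (∀ {k} → i Fin.< k → k Fin.< j → ¬ Same σ i k)
consecutive-pair π σ zero    j≤i i<j _ _ = contradiction j≤i (ℕ.<⇒≱ i<j)
consecutive-pair π σ (suc g) {i} {j} j≤ i<j σij ¬πij
  with Fin.any? (λ k → (i Fin.<? k) ×-dec ((k Fin.<? j) ×-dec same? σ i k))
... | no none = i , j , i<j , σij , ¬πij , λ i<k k<j σik → none (_ , i<k , k<j , σik)
... | yes (k , i<k , k<j , σik) with same? π i k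
...   | no ¬πik = consecutive-pair π σ g (ℕ.≤-pred (ℕ.≤-trans k<j j≤)) i<k σik ¬πik
...   | yes πik = consecutive-pair π σ g
        (ℕ.≤-trans j≤ (ℕ.≤-trans (ℕ.≤-reflexive (sym (ℕ.+-suc g (toℕ i)))) (ℕ.+-monoʳ-≤ g i<k))) k<j
        (same-trans σ (same-sym σ σik) σij) (¬πij ∘ same-trans π πik)

⊏⇒distinguished : (π σ : NC n) → π ⊏ σ → ∃₂ λ i j → i Fin.< j × Same σ i j × ¬ Same π i j
⊏⇒distinguished π σ (π⊑σ , π≢σ)
  with Fin.any? (λ i → Fin.any? λ j → same? σ i j ×-dec ¬? (same? π i j))
... | no none = contradiction
  (⊑-antisym {π = π} {σ} π⊑σ (Same⊆⇒⊑ σ π λ {i} {j} p →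
    decidable-stable (same? π i j) λ ¬p → none (i , j , p , ¬p))) π≢σ
... | yes (i , j , p , ¬p) with Fin.<-cmp i j
...   | tri< i<j _ _ = i , j , i<j , p , ¬p
...   | tri≈ _ refl _ = contradiction (same-refl π) ¬p
...   | tri> _ _ j<i = j , i , j<i , same-sym σ p , ¬p ∘ same-sym π

-- `merged` is strictly above `π` and at most `σ`, so the covering relation makes it equal to `σ`.
cover-generated : (π σ : NC n) → π ⋖ σ → ∃ λ e → Generates π (e ∷ []) σ
cover-generated {n} π σ π⋖σ = by-pair (⊏⇒distinguished π σ (proj₁ π⋖σ))
  where
  by-consecutive : (∃₂ λ i j → i Fin.< j × Same σ i j × ¬ Same π i j ×
                               (∀ {k} → i Fin.< k → k Fin.< j → ¬ Same σ i k)) →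
                   ∃ λ e → Generates π (e ∷ []) σ
  by-consecutive (i , j , i<j , σij , ¬πij , consecutive) = (i , j) , λ { f f-π (f-ij ∷ []) →
    subst (λ ρ → Constant ρ f) (⋖⇒≡ {π = π} {σ} {merged} π⋖σ (⊏merged ¬πij) merged⊑) (merged-generated f f-π f-ij) }
    where open Merge π σ (λ {x} → ⊑⇒block⊆ π σ (proj₁ (proj₁ π⋖σ)) x) σij i<j consecutive
  by-pair : (∃₂ λ i j → i Fin.< j × Same σ i j × ¬ Same π i j) → ∃ λ e → Generates π (e ∷ []) σ
  by-pair (i , j , i<j , σij , ¬πij) = by-consecutive (consecutive-pair π σ (toℕ j) (ℕ.m≤m+n _ _) i<j σij ¬πij)

-- Walks in the Hasse diagram

record WalkEdges (k : ℕ) (π ρ : NC n) : Set₁ where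
  field
    up down     : List (Edge (Fin n))
    total       : length up + length down ≡ k
    upwards     : Generates π up ρ
    downwards   : Generates ρ down π

-- A step up adds its pair to `up` and costs `down` nothing, since a function constant on the
-- coarser partition is constant on the finer one. Steps down are symmetric.
walk-edges : ∀ {k} (π ρ : NC n) → Walk k π ρ → WalkEdges k π ρ
walk-edges π .π [] = record
  { up = [] ; down = [] ; total = refl ; upwards = λ f c _ → c ; downwards = λ f c _ → c }
walk-edges {n} {suc k} π ρ (_∷_ {σ = σ} step w) = extend-by step
  where
  open WalkEdges (walk-edges σ ρ w)
  extend-by : Adjacent π σ → WalkEdges (suc k) π ρ
  extend-by (inj₁ π⋖σ) = record
    { up = proj₁ e ∷ up ; down = down ; total = cong suc total
    ; upwards   = λ { f c (fe ∷ f-up) → upwards f (proj₂ e f c (fe ∷ [])) f-up }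
    ; downwards = λ f c f-down {i} {j} ij → downwards f c f-down (⊑⇒block⊆ π σ (proj₁ (proj₁ π⋖σ)) i ij)
    }
    where e = cover-generated π σ π⋖σ
  extend-by (inj₂ σ⋖π) = record
    { up = up ; down = proj₁ e ∷ down ; total = trans (ℕ.+-suc (length up) (length down)) (cong suc total)
    ; upwards   = λ f c f-up → upwards f (λ {i} {j} ij → c (⊑⇒block⊆ σ π (proj₁ (proj₁ σ⋖π)) i ij)) f-up
    ; downwards = λ { f c (fe ∷ f-down) → proj₂ e f (downwards f c f-down) (fe ∷ []) }
    }
    where e = cover-generated σ π σ⋖π

-- Edges needed to connect a finite set

identify : ∀ {m} {p q : Fin (suc m)} → p ≢ q → Fin (suc m) → Fin m
identify {p = p} p≢q z with p Fin.≟ z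
... | yes _  = punchOut p≢q
... | no p≢z = punchOut p≢z

identify-≡ : ∀ {m} {p q : Fin (suc m)} (p≢q : p ≢ q) → identify p≢q p ≡ identify p≢q q
identify-≡ {p = p} {q} p≢q with p Fin.≟ p | p Fin.≟ q
... | _      | yes p≡q = contradiction p≡q p≢q
... | no p≢p | _       = contradiction refl p≢p
... | yes _  | no _    = Fin.punchOut-cong p refl

identify-surjective : ∀ {m} {p q : Fin (suc m)} (p≢q : p ≢ q) → StrictlySurjective _≡_ (identify p≢q)
identify-surjective {p = p} p≢q y = punchIn p y , eq
  where
  eq : identify p≢q (punchIn p y) ≡ y
  eq with p Fin.≟ punchIn p y
  ... | yes p≡ = contradiction (sym p≡) (Fin.punchInᵢ≢i p y)
  ... | no  p≢ = trans (Fin.punchOut-cong p refl) (Fin.punchOut-punchIn p)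

-- Contracting the edges one at a time loses at most one class per edge.
quotient : (E : List (Edge (Fin n))) → ∃₂ λ m (f : Fin n → Fin m) →
  StrictlySurjective _≡_ f × All (Joins f) E × n ≤ length E + m
quotient [] = _ , id , (λ y → y , refl) , [] , ℕ.≤-refl
quotient ((x , y) ∷ E) with quotient E
... | m , f , surj , f-E , n≤ with f x Fin.≟ f y
...   | yes fx≡fy = m , f , surj , fx≡fy ∷ f-E , ℕ.m≤n⇒m≤1+n n≤
quotient ((x , y) ∷ E) | suc m , f , surj , f-E , n≤ | no fx≢fy =
  m , identify fx≢fy ∘ f
  , (λ z → let (z′ , eq′) = identify-surjective fx≢fy z ; (w , eq) = surj z′ in
      w , trans (cong (identify fx≢fy) eq) eq′)
  , identify-≡ fx≢fy ∷ All.map (cong (identify fx≢fy)) f-E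
  , ℕ.≤-trans n≤ (ℕ.≤-reflexive (ℕ.+-suc (length E) m))
quotient ((x , y) ∷ E) | zero , f , _ | no _ = case f x of λ ()

-- The hypothesis makes the surjection from `quotient` constant, so at most one class remains.
connecting-≥ : (E : List (Edge (Fin n))) →
  (∀ {m} (f : Fin n → Fin m) → All (Joins f) E → ∀ x y → f x ≡ f y) → n ≤ suc (length E)
connecting-≥ E conn with quotient E
... | 0 , f , surj , f-E , n≤ = ℕ.≤-trans n≤ (ℕ.≤-trans (ℕ.≤-reflexive (ℕ.+-identityʳ _)) (ℕ.n≤1+n _))
... | 1 , f , surj , f-E , n≤ = ℕ.≤-trans n≤ (ℕ.≤-reflexive (ℕ.+-comm _ 1))
... | suc (suc m) , f , surj , f-E , n≤ with surj zero | surj (suc zero)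
...   | x , fx | y , fy with trans (sym fx) (trans (conn f f-E x y) fy)
...     | ()

-- The partitions of a tree in `NC n` and their distance

_≟ˢⁱᵈᵉ_ : DecidableEquality Side
L ≟ˢⁱᵈᵉ L = yes refl
L ≟ˢⁱᵈᵉ R = no λ ()
R ≟ˢⁱᵈᵉ L = no λ ()
R ≟ˢⁱᵈᵉ R = yes refl

_≟ᴸ_ : DecidableEquality Label
_≟ᴸ_ = ≡-decᴸ _≟ˢⁱᵈᵉ_

chains : ∀ n → Side → Tree → NC n
chains n b t = kernel _≟ᴸ_ (label b t ∘ toℕ) (label-nonCrossing b t)

chains-injective : ∀ b {t t′} → size t ≡ n → size t′ ≡ n → chains n b t ≡ chains n b t′ → t ≡ t′
chains-injective b {t} {t′} refl eq′ eq = label-injective b t t′ (sym eq′) λ i< j< → mk⇔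
  (transfer t t′ eq i< j<) (transfer t′ t (sym eq) i< j<)
  where
  transfer : ∀ u u′ → chains (size t) b u ≡ chains (size t) b u′ →
    ∀ {i j} → i < size t → j < size t → label b u i ≡ label b u j → label b u′ i ≡ label b u′ j
  transfer u u′ eq i< j< ij = subst₂ (λ i j → label b u′ i ≡ label b u′ j) (Fin.toℕ-fromℕ< i<) (Fin.toℕ-fromℕ< j<)
    (∈-kernelMap⁻ _≟ᴸ_ (label b u′ ∘ toℕ) (subst (λ π → Same π (Fin.fromℕ< i<) (Fin.fromℕ< j<)) eq
      (∈-kernelMap⁺ _≟ᴸ_ (label b u ∘ toℕ)
        (subst₂ (λ i j → label b u i ≡ label b u j) (sym (Fin.toℕ-fromℕ< i<)) (sym (Fin.toℕ-fromℕ< j<)) ij))))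

-- Pulls functions on `Fin (suc n)` back to ℕ, where the tree lemmas number positions. Larger
-- numbers go to the last element.
clamp : ∀ n → ℕ → Fin (suc n)
clamp n       zero    = zero
clamp zero    (suc i) = zero
clamp (suc n) (suc i) = suc (clamp n i)

clamp-toℕ : ∀ {n} (i : Fin (suc n)) → clamp n (toℕ i) ≡ i
clamp-toℕ         zero    = refl
clamp-toℕ {suc n} (suc i) = cong suc (clamp-toℕ i)

toℕ-clamp : ∀ {n i} → i < suc n → toℕ (clamp n i) ≡ i
toℕ-clamp {n}     {zero}  _         = refl
toℕ-clamp {suc n} {suc i} (s≤s i<n) = cong suc (toℕ-clamp i<n)

module _ {n : ℕ} (t : Tree) (size≡ : size t ≡ suc n) where

  private
    bounded : (i : Fin (suc n)) → toℕ i < size t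
    bounded i = subst (toℕ i <_) (sym size≡) (Fin.toℕ<n i)

    edgesᶠ : Side → List (Edge (Fin (suc n)))
    edgesᶠ b = map (λ (i , j) → clamp n i , clamp n j) (edges b t)

    unclamp : ∀ {A : Set} (f : Fin (suc n) → A) {i j} → f (clamp n (toℕ i)) ≡ f (clamp n (toℕ j)) → f i ≡ f j
    unclamp f {i} {j} = subst₂ (λ i j → f i ≡ f j) (clamp-toℕ i) (clamp-toℕ j)

    chains-generated : ∀ b {A : Set} (f : Fin (suc n) → A) → All (Joins f) (edgesᶠ b) → Constant (chains (suc n) b t) f
    chains-generated b f f-edges {i} {j} ij = unclamp f
      (edges-generate b t (f ∘ clamp n) (All.map⁻ f-edges) (bounded i) (bounded j) (∈-kernelMap⁻ _≟ᴸ_ (label b t ∘ toℕ) ij))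

    chains-connected : ∀ {A : Set} (f : Fin (suc n) → A) → (∀ b → Constant (chains (suc n) b t) f) → ∀ i j → f i ≡ f j
    chains-connected f f-const i j = unclamp f (jointly-connected t (f ∘ clamp n)
      (λ b x< y< xy → f-const b (∈-kernelMap⁺ _≟ᴸ_ (label b t ∘ toℕ)
        (subst₂ (λ x y → label b t x ≡ label b t y) (sym (toℕ-clamp (bound x<))) (sym (toℕ-clamp (bound y<))) xy)))
      (bounded i) (bounded j))
      where
      bound : ∀ {x} → x < size t → x < suc n
      bound = subst (_ <_) size≡

  chains-far : ∀ {k} → Walk k (chains (suc n) R t) (chains (suc n) L t) → n ≤ k
  -- Both bounds carry a `suc`; only the first keeps it, to match `#e-total`.
  chains-far {k} w = ℕ.+-cancelˡ-≤ (suc n) _ _ (begin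
    suc n + n                                     ≤⟨ ℕ.+-mono-≤ up-enough (ℕ.≤-pred down-enough) ⟩
    suc (#e R + length up) + (#e L + length down) ≡⟨ rearrange (#e R) (length up) (#e L) (length down) ⟩
    suc (#e L + #e R) + (length up + length down) ≡⟨ cong₂ _+_ #e-total total ⟩
    suc n + k                                     ∎)
    where
    open ℕ.≤-Reasoning
    open WalkEdges (walk-edges (chains (suc n) R t) (chains (suc n) L t) w)
    #e : Side → ℕ
    #e b = length (edges b t)
    rearrange : ∀ a u c d → suc (a + u) + (c + d) ≡ suc (c + a) + (u + d)
    rearrange = solve-∀
    #e-total : suc (#e L + #e R) ≡ suc n
    #e-total = trans (suc-#edges t size≡) size≡
      where
      suc-#edges : ∀ t → size t ≡ suc n → suc (#edges t) ≡ size t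
      suc-#edges (node l r) _ = #edges-node l r
    -- `both` expresses that `b` and `b′` are the two sides, so that constancy on both partitions
    -- can be passed to `chains-connected`.
    enough : ∀ b b′ E → (∀ {P : Side → Set} → P b → P b′ → ∀ c → P c) →
      Generates (chains (suc n) b t) E (chains (suc n) b′ t) → suc n ≤ suc (#e b + length E)
    enough b b′ E both gen = ℕ.≤-trans (connecting-≥ (edgesᶠ b ++ E) λ f f-edges → chains-connected f
        (both {λ c → Constant (chains (suc n) c t) f} (chains-generated b f (All.++⁻ˡ (edgesᶠ b) f-edges))
              (gen f (chains-generated b f (All.++⁻ˡ (edgesᶠ b) f-edges)) (All.++⁻ʳ (edgesᶠ b) f-edges))))
      (ℕ.≤-reflexive (cong suc (trans (length-++ (edgesᶠ b)) (cong (_+ length E) (length-map _ (edges b t))))))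
    up-enough : suc n ≤ suc (#e R + length up)
    up-enough = enough R L up (λ { p q R → p ; p q L → q }) upwards
    down-enough : suc n ≤ suc (#e L + length down)
    down-enough = enough L R down (λ { p q L → p ; p q R → q }) downwards

-- Counting trees

sizes : ∀ {k} → Vec Tree k → ℕ
sizes = Vec.sum ∘ Vec.map size

join : ∀ {k} → Vec Tree (2 + k) → Vec Tree (suc k)
join (l ∷ r ∷ ts) = node l r ∷ ts

-- Forests of `k` trees with `n` nodes in all: the first tree is a leaf, or its root is removed,
-- leaving two trees and one node fewer. Admitting all `k` makes the count a two-term recurrence.
forests : (n k : ℕ) → List (Vec Tree k)
forests zero    zero    = [] ∷ []
forests (suc n) zero    = []
forests zero    (suc k) = map (leaf ∷_) (forests zero k)
forests (suc n) (suc k) = map (leaf ∷_) (forests (suc n) k) ++ map join (forests n (2 + k))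

leaf-sizes : ∀ {n k} {fs : List (Vec Tree k)} → (∀ {ts} → ts ∈ fs → sizes ts ≡ n) →
             ∀ {ts} → ts ∈ map (leaf ∷_) fs → sizes ts ≡ n
leaf-sizes h ts∈ with _ , us∈ , refl ← ∈-map⁻ (leaf ∷_) ts∈ = h us∈

join-sizes : ∀ {n k} {fs : List (Vec Tree (2 + k))} → (∀ {ts} → ts ∈ fs → sizes ts ≡ n) →
             ∀ {ts} → ts ∈ map join fs → sizes ts ≡ suc n
join-sizes h ts∈ with l ∷ r ∷ us , us∈ , refl ← ∈-map⁻ join ts∈ =
  trans (rearrange (size l) (size r) (sizes us)) (cong suc (h us∈))
  where
  rearrange : ∀ l r s → (l + suc r) + s ≡ suc (l + (r + s))
  rearrange = solve-∀

forests-sizes : ∀ n k {ts} → ts ∈ forests n k → sizes ts ≡ n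
forests-sizes zero    zero    (here refl) = refl
forests-sizes zero    (suc k) ts∈ = leaf-sizes (forests-sizes zero k) ts∈
forests-sizes (suc n) (suc k) ts∈ = [ leaf-sizes (forests-sizes (suc n) k) , join-sizes (forests-sizes n (2 + k)) ]′
  (∈-++⁻ (map (leaf ∷_) (forests (suc n) k)) ts∈)

forests-unique : ∀ n k → Unique (forests n k)
forests-unique zero    zero    = [] ∷ []
forests-unique (suc n) zero    = []
forests-unique zero    (suc k) = Unique.map⁺ Vec.∷-injectiveʳ (forests-unique zero k)
forests-unique (suc n) (suc k) = Unique.++⁺ (Unique.map⁺ Vec.∷-injectiveʳ (forests-unique (suc n) k))
  (Unique.map⁺ join-injective (forests-unique n (2 + k))) λ (∈l , ∈n) →
    disjoint (proj₂ (proj₂ (∈-map⁻ (leaf ∷_) ∈l))) (proj₂ (proj₂ (∈-map⁻ join ∈n)))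
  where
  join-injective : ∀ {k} {ts us : Vec Tree (2 + k)} → join ts ≡ join us → ts ≡ us
  join-injective {ts = _ ∷ _ ∷ _} {_ ∷ _ ∷ _} refl = refl
  disjoint : ∀ {k} {ts : Vec Tree (suc k)} {us vs} → ts ≡ leaf ∷ us → ts ≡ join vs → ⊥
  disjoint {vs = _ ∷ _ ∷ _} refl ()

length-forests-0 : ∀ k → length (forests 0 k) ≡ 1
length-forests-0 zero    = refl
length-forests-0 (suc k) = trans (length-map _ (forests 0 k)) (length-forests-0 k)

-- Induction step for the closed form, with denominators cleared: a common factorial `x` is left,
-- and the rest is a polynomial identity.
length-forests-suc : ∀ n k →
  length (forests (suc n) k) * (suc n ! * (suc n + k) !) ≡ k * (2 * n + suc k) ! →
  length (forests n (2 + k)) * (n ! * (n + (2 + k)) !) ≡ (2 + k) * (2 * n + suc k) ! →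
  length (forests (suc n) (suc k)) * (suc n ! * (suc n + suc k) !) ≡ suc k * (2 * suc n + k) !
length-forests-suc n k leaf-first node-first = begin
  length (forests (suc n) (suc k)) * (suc n ! * (suc n + suc k) !)
    ≡⟨ cong₂ (λ x y → x * (suc n ! * y !)) split (ℕ.+-suc (suc n) k) ⟩
  (a + b) * (suc n * n ! * (suc (suc n + k) * v))
    ≡⟨ distribute a b (suc n) (n !) (suc (suc n + k)) v ⟩
  suc (suc n + k) * (a * (suc n ! * v)) + suc n * (b * (n ! * (suc (suc n + k) * v)))
    ≡⟨ cong₂ (λ x y → suc (suc n + k) * x + suc n * y) leaf-first node-first′ ⟩
  suc (suc n + k) * (k * x) + suc n * ((2 + k) * x)
    ≡⟨ combine n k x ⟩
  suc k * (suc (2 * n + suc k) * x)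
    ≡⟨ cong (λ y → suc k * y !) (index n k) ⟨
  suc k * (2 * suc n + k) ! ∎
  where
  open ≡-Reasoning
  a = length (forests (suc n) k)
  b = length (forests n (2 + k))
  v = (suc n + k) !
  x = (2 * n + suc k) !
  split : length (forests (suc n) (suc k)) ≡ a + b
  split = trans (length-++ (map (leaf ∷_) (forests (suc n) k)))
    (cong₂ _+_ (length-map _ (forests (suc n) k)) (length-map join (forests n (2 + k))))
  node-first′ : b * (n ! * (suc (suc n + k) * v)) ≡ (2 + k) * x
  node-first′ = trans (cong (λ y → b * (n ! * y !)) (sym (trans (ℕ.+-suc n (suc k)) (cong suc (ℕ.+-suc n k))))) node-first
  index : ∀ n k → 2 * suc n + k ≡ suc (2 * n + suc k)
  index = solve-∀
  distribute : ∀ a b m p s v → (a + b) * (m * p * (s * v)) ≡ s * (a * (m * p * v)) + m * (b * (p * (s * v)))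
  distribute = solve-∀
  combine : ∀ n k x → suc (suc n + k) * (k * x) + suc n * ((2 + k) * x) ≡ suc k * (suc (2 * n + suc k) * x)
  combine = solve-∀

-- The number of forests is (k + 1) / (2n + k + 1) · C(2n + k + 1, n).
length-forests : ∀ n k → length (forests n (suc k)) * (n ! * (n + suc k) !) ≡ suc k * (2 * n + k) !
length-forests zero k = begin
  length (forests 0 (suc k)) * (1 * suc k !)  ≡⟨ cong (_* (1 * suc k !)) (length-forests-0 (suc k)) ⟩
  1 * (1 * suc k !)                           ≡⟨ trans (ℕ.*-identityˡ _) (ℕ.*-identityˡ _) ⟩
  suc k * k !                                 ∎
  where open ≡-Reasoning
-- An empty forest has no nodes, so the leaf-first hypothesis reads 0 = 0.
length-forests (suc n) zero    = length-forests-suc n 0 refl (length-forests n 1)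
length-forests (suc n) (suc k) = length-forests-suc n (suc k)
  (trans (length-forests (suc n) k) (cong (λ y → suc k * y !) (index n k)))
  (length-forests n (2 + k))
  where
  index : ∀ n k → 2 * suc n + k ≡ 2 * n + suc (suc k)
  index = solve-∀

single : Vec Tree 1 → Tree
single (t ∷ []) = t

trees : ℕ → List Tree
trees n = map single (forests n 1)

trees-size : ∀ n {t} → t ∈ trees n → size t ≡ n
trees-size n t∈ with t ∷ [] , ts∈ , refl ← ∈-map⁻ single t∈ =
  trans (sym (ℕ.+-identityʳ (size t))) (forests-sizes n 1 ts∈)

trees-unique : ∀ n → Unique (trees n)
trees-unique n = Unique.map⁺ {f = single} (λ { {_ ∷ []} {_ ∷ []} refl → refl }) (forests-unique n 1)

length-trees : ∀ n → length (trees n) * (n ! * suc n !) ≡ (2 * n) !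
length-trees n = begin
  length (trees n) * (n ! * suc n !)
    ≡⟨ cong₂ (λ x y → x * (n ! * y !)) (length-map single (forests n 1)) (ℕ.+-comm 1 n) ⟩
  length (forests n 1) * (n ! * (n + 1) !)
    ≡⟨ length-forests n 0 ⟩
  1 * (2 * n + 0) !
    ≡⟨ ℕ.*-identityˡ _ ⟩
  (2 * n + 0) !
    ≡⟨ cong _! (ℕ.+-identityʳ (2 * n)) ⟩
  (2 * n) ! ∎
  where open ≡-Reasoning

-- Finite sums and the summation over trees

module _ {A : Set} where

  ∑ : List A → (A → ℕ) → ℕ
  ∑ xs f = sum (map f xs)

  ∑-mono : ∀ (xs : List A) f g → (∀ {x} → x ∈ xs → f x ≤ g x) → ∑ xs f ≤ ∑ xs g
  ∑-mono []       f g h = z≤n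
  ∑-mono (x ∷ xs) f g h = ℕ.+-mono-≤ (h (here refl)) (∑-mono xs f g (h ∘ there))

  ∑-+ : ∀ (xs : List A) f g → ∑ xs (λ x → f x + g x) ≡ ∑ xs f + ∑ xs g
  ∑-+ []       f g = refl
  ∑-+ (x ∷ xs) f g = trans (cong (f x + g x +_) (∑-+ xs f g)) (rearrange (f x) (g x) (∑ xs f) (∑ xs g))
    where
    rearrange : ∀ a b c d → a + b + (c + d) ≡ a + c + (b + d)
    rearrange = solve-∀

  ∑-const : ∀ (xs : List A) c → ∑ xs (λ _ → c) ≡ length xs * c
  ∑-const []       c = refl
  ∑-const (x ∷ xs) c = cong (c +_) (∑-const xs c)

  ∑-middle : ∀ as {x : A} {bs} f → ∑ (as ++ x ∷ bs) f ≡ f x + ∑ (as ++ bs) f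
  ∑-middle []       f = refl
  ∑-middle (a ∷ as) {x} {bs} f = trans (cong (f a +_) (∑-middle as f)) (rearrange (f a) (f x) (∑ (as ++ bs) f))
    where
    rearrange : ∀ a b c → a + (b + c) ≡ b + (a + c)
    rearrange = solve-∀

∑-swap : ∀ {A B : Set} (xs : List A) (ys : List B) (f : A → B → ℕ) →
         ∑ xs (λ x → ∑ ys (f x)) ≡ ∑ ys (λ y → ∑ xs λ x → f x y)
∑-swap []       ys f = trans (sym (ℕ.*-zeroʳ (length ys))) (sym (∑-const ys 0))
∑-swap (x ∷ xs) ys f = trans (cong (∑ ys (f x) +_) (∑-swap xs ys f)) (sym (∑-+ ys (f x) _))

-- Remove one occurrence of `h x` from `ys`; by injectivity and uniqueness the images of the other
-- entries survive.
∑-injective-≤ : ∀ {A B : Set} (h : A → B) {xs : List A} (ys : List B) (f : B → ℕ) → Unique xs →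
  (∀ {x y} → x ∈ xs → y ∈ xs → h x ≡ h y → x ≡ y) → (∀ {x} → x ∈ xs → h x ∈ ys) →
  ∑ xs (f ∘ h) ≤ ∑ ys f
∑-injective-≤ h {[]}     ys f _ _ _ = z≤n
∑-injective-≤ h {x ∷ xs} ys f (x∉ ∷ u) inj sub with as , bs , refl ← ∈-∃++ (sub (here refl)) = ℕ.≤-trans
  (ℕ.+-monoʳ-≤ (f (h x)) (∑-injective-≤ h (as ++ bs) f u (λ p q → inj (there p) (there q)) sub′))
  (ℕ.≤-reflexive (sym (∑-middle as f)))
  where
  sub′ : ∀ {y} → y ∈ xs → h y ∈ as ++ bs
  sub′ {y} y∈ with ∈-++⁻ as (sub (there y∈))
  ... | inj₁ p          = ∈-++⁺ˡ p
  ... | inj₂ (there p)  = ∈-++⁺ʳ as p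
  ... | inj₂ (here eq)  with () ← All.lookup x∉ y∈ (inj (here refl) (there y∈) (sym eq))

totalDistance : ℕ → ℕ
totalDistance n = ∑NC {n} λ π → ∑NC {n} λ ρ → d-H π ρ

module _ (n : ℕ) where

  private
    N : ℕ
    N = suc n
    ts : List Tree
    ts = trees N
    Π : Side → Tree → NC N
    Π = chains N

  ∑-chains-≤ : ∀ b (f : NC N → ℕ) → ∑ ts (λ t → f (Π b t)) ≤ ∑NC f
  ∑-chains-≤ b f = ∑-injective-≤ (Π b) (allNC N) f (trees-unique N)
    (λ p q → chains-injective b (trees-size N p) (trees-size N q))
    (λ _ → allNC-complete _)

  length-trees≤ : length ts ≤ length (allNC N)
  length-trees≤ = subst₂ _≤_ (count ts) (count (allNC N)) (∑-chains-≤ R (λ _ → 1))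
    where
    count : ∀ {A : Set} (xs : List A) → ∑ xs (λ _ → 1) ≡ length xs
    count xs = trans (∑-const xs 1) (ℕ.*-identityʳ (length xs))

  -- Sum `far` over all trees and all `ρ`. The distances from `Π R t` and those to `Π L t` are each
  -- part of the full double sum, whence the factor 2.
  ∑∑-≥ : (d : NC N → NC N → ℕ) → (∀ t → size t ≡ N → ∀ ρ → n ≤ d (Π R t) ρ + d ρ (Π L t)) →
          length ts * length ts * n ≤ 2 * ∑NC λ π → ∑NC (d π)
  ∑∑-≥ d far = begin
    length ts * length ts * n
      ≤⟨ ℕ.*-monoˡ-≤ n (ℕ.*-monoʳ-≤ (length ts) length-trees≤) ⟩
    length ts * length (allNC N) * n
      ≡⟨ ℕ.*-assoc (length ts) (length (allNC N)) n ⟩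
    length ts * (length (allNC N) * n)
      ≡⟨ cong (length ts *_) (∑-const (allNC N) n) ⟨
    length ts * ∑NC {N} (λ _ → n)
      ≡⟨ ∑-const ts (∑NC {N} λ _ → n) ⟨
    ∑ ts (λ _ → ∑NC {N} λ _ → n)
      ≤⟨ ∑-mono ts (λ _ → ∑NC {N} λ _ → n) (λ t → ∑NC λ ρ → d (Π R t) ρ + d ρ (Π L t))
           (λ {t} t∈ → ∑-mono (allNC N) (λ _ → n) (λ ρ → d (Π R t) ρ + d ρ (Π L t))
             λ {ρ} _ → far t (trees-size N t∈) ρ) ⟩
    ∑ ts (λ t → ∑NC λ ρ → d (Π R t) ρ + d ρ (Π L t))
      ≤⟨ ∑-mono ts (λ t → ∑NC λ ρ → d (Π R t) ρ + d ρ (Π L t)) (λ t → fromR t + toL t)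
           (λ {t} _ → ℕ.≤-reflexive (∑-+ (allNC N) (d (Π R t)) (λ ρ → d ρ (Π L t)))) ⟩
    ∑ ts (λ t → fromR t + toL t)
      ≡⟨ ∑-+ ts fromR toL ⟩
    ∑ ts fromR + ∑ ts toL
      ≡⟨ cong (∑ ts fromR +_) (∑-swap ts (allNC N) (λ t ρ → d ρ (Π L t))) ⟩
    ∑ ts fromR + ∑NC (λ ρ → ∑ ts λ t → d ρ (Π L t))
      ≤⟨ ℕ.+-mono-≤ (∑-chains-≤ R (λ π → ∑NC (d π)))
           (∑-mono (allNC N) (λ ρ → ∑ ts λ t → d ρ (Π L t)) (λ ρ → ∑NC (d ρ)) λ {ρ} _ → ∑-chains-≤ L (d ρ)) ⟩
    total + total
      ≡⟨ cong (total +_) (ℕ.+-identityʳ (total)) ⟨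
    2 * total ∎
    where
    open ℕ.≤-Reasoning
    total : ℕ
    total = ∑NC λ π → ∑NC (d π)
    fromR toL : Tree → ℕ
    fromR t = ∑NC (d (Π R t))
    toL   t = ∑NC (λ ρ → d ρ (Π L t))

-- Shortest walks to and from `ρ` concatenate to a walk that `chains-far` bounds.
chains-triangle : ∀ n t → size t ≡ suc n → ∀ ρ →
                  n ≤ d-H (chains (suc n) R t) ρ + d-H ρ (chains (suc n) L t)
chains-triangle n t size≡ ρ = chains-far t size≡ (append
  (proj₁ (d-H-isDistance (chains (suc n) R t) ρ))
  (proj₁ (d-H-isDistance ρ (chains (suc n) L t))))

-- Not opened earlier, where +_ would clash with the sections of _+_.
open import Data.Integer using (+_; _-_)

-- Passage to rational numbers

*-/-cancel : ∀ c d .{{_ : NonZero d}} → + (c * d) / d ≡ + c / 1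
*-/-cancel c (suc d) = ℚ.fromℚᵘ-cong {ℚᵘ.mkℚᵘ (+ (c * suc d)) d} {ℚᵘ.mkℚᵘ (+ c) 0}
  (ℚᵘ.*≡* (trans (ℤ.*-identityʳ _) (ℤ.pos-* c (suc d))))

Cat-trees : ∀ n → Cat n ≡ + length (trees n) / 1
Cat-trees n = trans
  (cong (λ a → (+ a / (n ! * suc n !)) {{nz}}) (sym (length-trees n)))
  (*-/-cancel (length (trees n)) (n ! * suc n !) {{nz}})
  where nz = m*n≢0 (n !) (suc n !) {{n !≢0}} {{suc n !≢0}}

-- Over unnormalised fractions the claim cross-multiplies to the given inequality of integers.
scaled-≤ : ∀ c m s → c * c * m ≤ 2 * s → (+ c / 1 ℚ.* (+ c / 1)) ℚ.* (+ m / 2) ℚ.≤ + s / 1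
scaled-≤ c m s c²m≤2s = ℚ.toℚᵘ-cancel-≤ (ℚᵘ.≤-respˡ-≃ (ℚᵘ.≃-sym lhs) (ℚᵘ.≤-respʳ-≃ (ℚᵘ.≃-sym (ℚ.toℚᵘ-fromℚᵘ s′))
  (ℚᵘ.*≤* (subst₂ ℤ._≤_ lhs-ℤ rhs-ℤ (ℤ.+≤+ c²m≤2s)))))
  where
  c′ = ℚᵘ.mkℚᵘ (+ c) 0
  m′ = ℚᵘ.mkℚᵘ (+ m) 1
  s′ = ℚᵘ.mkℚᵘ (+ s) 0
  c/1 = + c / 1
  lhs : ℚ.toℚᵘ ((c/1 ℚ.* c/1) ℚ.* (+ m / 2)) ℚᵘ.≃ (c′ ℚᵘ.* c′) ℚᵘ.* m′
  lhs = ℚᵘ.≃-trans (ℚ.toℚᵘ-homo-* (c/1 ℚ.* c/1) (+ m / 2)) (ℚᵘ.*-cong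
    (ℚᵘ.≃-trans (ℚ.toℚᵘ-homo-* c/1 c/1) (ℚᵘ.*-cong (ℚ.toℚᵘ-fromℚᵘ c′) (ℚ.toℚᵘ-fromℚᵘ c′)))
    (ℚ.toℚᵘ-fromℚᵘ m′))
  lhs-ℤ : + (c * c * m) ≡ + c ℤ.* + c ℤ.* + m ℤ.* + 1
  lhs-ℤ = trans (trans (ℤ.pos-* (c * c) m) (cong (ℤ._* + m) (ℤ.pos-* c c))) (sym (ℤ.*-identityʳ _))
  rhs-ℤ : + (2 * s) ≡ + s ℤ.* + 2
  rhs-ℤ = trans (cong +_ (ℕ.*-comm 2 s)) (ℤ.pos-* s 2)

≤-1/* : ∀ p q r .{{_ : ℚ.Positive p}} .{{_ : ℚ.NonZero p}} → p ℚ.* q ℚ.≤ r → q ℚ.≤ 1/ p ℚ.* r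
≤-1/* p q r pq≤r = ℚ.*-cancelˡ-≤-pos p (subst (p ℚ.* q ℚ.≤_) (sym cancel) pq≤r)
  where
  cancel : p ℚ.* (1/ p ℚ.* r) ≡ r
  cancel = trans (sym (ℚ.*-assoc p (1/ p) r)) (trans (cong (ℚ._* r) (ℚ.*-inverseʳ p)) (ℚ.*-identityˡ r))

corollary4p8 : (n : ℕ) .{{_ : NonZero n}} →
    (1/ (Cat n ℚ.* Cat n)) {{Cat²-nonZero n}} ℚ.*
    (+ (∑NC {n} λ π → ∑NC {n} λ ρ → d-H π ρ) / 1)
    ≥ (+ n - + 1) / 2
-- With `suc n` for the size, the numerator `+ suc n - + 1` computes to `+ n`.
corollary4p8 (suc n) = ≤-1/* (Cat N ℚ.* Cat N) (+ n / 2) (+ totalDistance N / 1)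
  {{ℚ.pos*pos⇒pos (Cat N) {{Cat-positive N}} (Cat N) {{Cat-positive N}}}} {{Cat²-nonZero N}}
  (subst (λ c → (c ℚ.* c) ℚ.* (+ n / 2) ℚ.≤ + totalDistance N / 1) (sym (Cat-trees N))
    (scaled-≤ (length (trees N)) n (totalDistance N) (∑∑-≥ n d-H (chains-triangle n))))
  where N = suc n
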